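{- For any CBGT instance $(E,\mathcal{I},g)$ where $(E,\mathcal{I})$ is a laminar matroid, there is an infinite valid schedule $\pi$ with $h(\pi)<4$. Furthermore, $\pi$ can be implemented in polynomial time.
   Context: An instance of Combinatorial Bamboo Garden Trimming (CBGT) is a triple $(E,\mathcal{I},g)$ where $E$ is a finite set (of "bamboos"), $\mathcal{I}\subseteq 2^E$ is a family of subsets of $E$, and $g\in\mathbb{Q}_{\ge 0}^E$ is a vector of growth rates such that there are coefficients $\lambda(I)\ge 0$ ($I\in\mathcal{I}$) with $\sum_{I\in\mathcal{I}}\lambda(I)=1$ and $g(e)=\sum_{I\in\mathcal{I}:\, e\in I}\lambda(I)$ for every $e\in E$. Let $\mathbb{N}=\{1,2,\dots\}$. An infinite schedule is a sequence $\pi=\pi(1),\pi(2),\dots$ of subsets of $E$; it is valid if $\pi(t)\in\mathcal{I}$ for all $t\in\mathbb{N}$. $h^\pi_t(e)$ denotes the height of $e$ on day $t$ after growing but before $\pi(t)$ is cut, i.e. $h^\pi_1(e)=g(e)$, and $h^\pi_{t+1}(e)=g(e)$ if $e\in\pi(t)$, $h^\pi_{t+1}(e)=h^\pi_t(e)+g(e)$ otherwise. The height of $\pi$ is $h(\pi)=\max_{e\in E}\sup_{t\in\mathbb{N}}h^\pi_t(e)$. A family $\mathcal{L}\subseteq 2^E$ is laminar if for all $L,L'\in\mathcal{L}$ we have $L\subseteq L'$, $L'\subseteq L$ or $L\cap L'=\emptyset$. A matroid $(E,\mathcal{I})$ is laminar if there are a laminar family $\mathcal{L}$ and a function $b:\mathcal{L}\to\mathbb{N}$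 with $\mathcal{I}=\{I\subseteq E : |I\cap L|\le b(L)\text{ for all }L\in\mathcal{L}\}$; it is given to an algorithm by $\mathcal{L}$ and $b$. An algorithm implements $\pi$ if it outputs $\pi(1),\pi(2),\dots$ one step at a time; polynomial time means that preprocessing and the computation of each next set take time polynomial in the input size. -}

module Defs where

open import Data.Bool using (Bool; true; false; if_then_else_)
open import Data.Digit using (Bit; toDigits)
open import Data.Fin using (Fin; zero; suc)
open import Data.Fin.Subset using (Subset; inside; outside; _∈_; _∉_; _⊆_; _∩_; _∪_; ⁅_⁆; ⊥; ∣_∣)
open import Data.Fin.Subset.Properties using (_∈?_)
open import Data.Integer as ℤ using ()
open import Data.List using (List; []; _∷_; [_]; _++_; map; filter; foldr; allFin)
import Data.List.Membership.Propositional as List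
open import Data.List.Relation.Unary.Unique.Propositional using (Unique)
open import Data.Nat as ℕ using (ℕ; zero; suc; NonZero)
open import Data.Product using (Σ-syntax; ∃-syntax; _×_; proj₁)
open import Data.Rational using (ℚ; 0ℚ; 1ℚ; _+_; _≤_; _<_; ↥_; ↧ₙ_)
open import Data.Sum using (_⊎_)
open import Data.Vec using (toList; []; _∷_)
open import Function.Bundles using (_⇔_)
open import Level using (0ℓ)
open import Relation.Binary.PropositionalEquality using (_≡_)
open import Relation.Nullary using (does)
open import Relation.Unary using (Pred; Decidable)

------------------------------------------------------------------------
-- Bamboo gardens on the ground set E = Fin n

subsets : ∀ n → List (Subset n)
subsets zero    = [ [] ]
subsets (suc n) = map (outside ∷_) (subsets n) ++ map (inside ∷_) (subsets n)

∑ : ∀ {A : Set} → List A → (A → ℚ) → ℚ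
∑ xs f = foldr _+_ 0ℚ (map f xs)

-- Decidability of 𝓘 expresses that it is a subset of the finite set 2^E;
-- it is what makes sums over 𝓘 meaningful.

record CBGT (n : ℕ) : Set₁ where
  field
    𝓘  : Pred (Subset n) 0ℓ
    𝓘? : Decidable 𝓘
    g  : Fin n → ℚ

  members : List (Subset n)
  members = filter 𝓘? (subsets n)

  field
    g-nonneg : ∀ e → 0ℚ ≤ g e
    g-convex : Σ[ λ′ ∈ (Subset n → ℚ) ]
                 (∀ I → 𝓘 I → 0ℚ ≤ λ′ I)
               × ∑ members λ′ ≡ 1ℚ
               × (∀ e → g e ≡ ∑ (filter (e ∈?_) members) λ′)

-- Days are numbered from 0, so π t is the set cut on day t + 1.

Schedule : ℕ → Set
Schedule n = ℕ → Subset n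

module _ {n : ℕ} (G : CBGT n) where
  open CBGT G

  Valid : Schedule n → Set
  Valid π = ∀ t → 𝓘 (π t)

  heightOn : Schedule n → ℕ → Fin n → ℚ
  heightOn π zero    e = g e
  heightOn π (suc t) e = if does (e ∈? π t) then g e else heightOn π t e + g e

  -- h(π) < c.  The supremum h(π) is a real number (or ∞), given here by its
  -- upper cut: c lies strictly above it iff some c′ < c bounds all heights.
  -- This is stronger than every single height being below c.

  HeightBelow : Schedule n → ℚ → Set
  HeightBelow π c = ∃[ c′ ] c′ < c × (∀ e t → heightOn π t e ≤ c′)

------------------------------------------------------------------------
-- Laminar matroids

record IsMatroid {n : ℕ} (𝓘 : Pred (Subset n) 0ℓ) : Set where
  field
    empty      : 𝓘 ⊥
    hereditary : ∀ {I J} → I ⊆ J → 𝓘 J → 𝓘 I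
    exchange   : ∀ {I J} → 𝓘 I → 𝓘 J → ∣ I ∣ ℕ.< ∣ J ∣ →
                 ∃[ e ] e ∈ J × e ∉ I × 𝓘 (I ∪ ⁅ e ⁆)

IsLaminar : ∀ {n} → List (Subset n) → Set
IsLaminar 𝓛 = ∀ {L L′} → L List.∈ 𝓛 → L′ List.∈ 𝓛 →
              L ⊆ L′ ⊎ L′ ⊆ L ⊎ L ∩ L′ ≡ ⊥

-- The family 𝓛 is listed without repetition, in arbitrary order.
-- Only the values of b on 𝓛 matter.

record LaminarMatroid {n : ℕ} (𝓘 : Pred (Subset n) 0ℓ) : Set where
  field
    isMatroid  : IsMatroid 𝓘
    𝓛          : List (Subset n)
    𝓛-unique   : Unique 𝓛
    𝓛-laminar  : IsLaminar 𝓛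
    b          : Subset n → ℕ
    b-positive : ∀ {L} → L List.∈ 𝓛 → NonZero (b L)
    𝓘⇔         : ∀ I → 𝓘 I ⇔ (∀ {L} → L List.∈ 𝓛 → ∣ I ∩ L ∣ ℕ.≤ b L)

------------------------------------------------------------------------
-- Model of computation: while-programs over binary trees, i.e. Jones's
-- language WHILE ("Computability and Complexity from a Programming
-- Perspective"), in point-free form: a program transforms one tree, and
-- local variables are kept in components of that tree.  Every operation
-- copies, builds or follows O(1) pointers to immutable cells, so unit costs
-- are realistic, and polynomial time agrees with that of Turing machines.

infixr 5 _∙_

data Tree : Set where
  nil : Tree
  _∙_ : Tree → Tree → Tree

size : Tree → ℕ
size nil     = 1
size (a ∙ b) = suc (size a ℕ.+ size b)

infixr 4 _⨾_

data Prog : Set where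
  skip nil hd tl : Prog
  ⟨_,_⟩          : Prog → Prog → Prog
  _⨾_            : Prog → Prog → Prog
  cond           : Prog → Prog → Prog → Prog
  while          : Prog → Prog → Prog

-- P ∶ x ⇓ y [ k ]: started on x, the program P halts with result y after k
-- steps.  As tests, nil is false and every other tree is true; hd and tl
-- send nil to nil.

infix 3 _∶_⇓_[_]

data _∶_⇓_[_] : Prog → Tree → Tree → ℕ → Set where

  ⇓skip   : ∀ {x} → skip ∶ x ⇓ x [ 1 ]

  ⇓nil    : ∀ {x} → nil ∶ x ⇓ nil [ 1 ]

  ⇓hd-nil : hd ∶ nil ⇓ nil [ 1 ]
  ⇓hd     : ∀ {x y} → hd ∶ x ∙ y ⇓ x [ 1 ]

  ⇓tl-nil : tl ∶ nil ⇓ nil [ 1 ]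
  ⇓tl     : ∀ {x y} → tl ∶ x ∙ y ⇓ y [ 1 ]

  ⇓pair   : ∀ {P Q x y z k l} →
            P ∶ x ⇓ y [ k ] → Q ∶ x ⇓ z [ l ] →
            ⟨ P , Q ⟩ ∶ x ⇓ y ∙ z [ suc (k ℕ.+ l) ]

  ⇓seq    : ∀ {P Q x y z k l} →
            P ∶ x ⇓ y [ k ] → Q ∶ y ⇓ z [ l ] →
            P ⨾ Q ∶ x ⇓ z [ suc (k ℕ.+ l) ]

  ⇓then   : ∀ {B P Q x u v y k l} →
            B ∶ x ⇓ u ∙ v [ k ] → P ∶ x ⇓ y [ l ] →
            cond B P Q ∶ x ⇓ y [ suc (k ℕ.+ l) ]
  ⇓else   : ∀ {B P Q x y k l} →
            B ∶ x ⇓ nil [ k ] → Q ∶ x ⇓ y [ l ] →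
            cond B P Q ∶ x ⇓ y [ suc (k ℕ.+ l) ]

  ⇓stop   : ∀ {B P x k} →
            B ∶ x ⇓ nil [ k ] →
            while B P ∶ x ⇓ x [ suc k ]
  ⇓loop   : ∀ {B P x u v y z k l m} →
            B ∶ x ⇓ u ∙ v [ k ] → P ∶ x ⇓ y [ l ] → while B P ∶ y ⇓ z [ m ] →
            while B P ∶ x ⇓ z [ suc (k ℕ.+ l ℕ.+ m) ]

infix 3 _∶_⇓_within_

_∶_⇓_within_ : Prog → Tree → Tree → ℕ → Set
P ∶ x ⇓ y within T = ∃[ k ] k ℕ.≤ T × P ∶ x ⇓ y [ k ]

-- Preprocessing turns the input into a state; each run of step turns the
-- current state into the next set to be cut, paired with the next state.

record Algorithm : Set where
  field
    preprocess : Prog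
    step       : Prog

------------------------------------------------------------------------
-- Inputs and outputs as trees

encodeList : ∀ {A : Set} → (A → Tree) → List A → Tree
encodeList f []       = nil
encodeList f (x ∷ xs) = f x ∙ encodeList f xs

encodeBool : Bool → Tree
encodeBool false = nil
encodeBool true  = nil ∙ nil

encodeBit : Bit → Tree
encodeBit zero    = nil
encodeBit (suc _) = nil ∙ nil

-- In binary, least significant bit first.

encodeℕ : ℕ → Tree
encodeℕ m = encodeList encodeBit (proj₁ (toDigits 2 m))

-- Growth rates are nonnegative, so the sign is not recorded.

encodeℚ≥0 : ℚ → Tree
encodeℚ≥0 q = encodeℕ ℤ.∣ ↥ q ∣ ∙ encodeℕ (↧ₙ q)

encodeSubset : ∀ {n} → Subset n → Tree
encodeSubset S = encodeList encodeBool (toList S)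

-- The convex coefficients of g are not part of the input.

encodeInput : ∀ {n} (G : CBGT n) → LaminarMatroid (CBGT.𝓘 G) → Tree
encodeInput {n} G M =
  encodeList (λ e → encodeℚ≥0 (g e)) (allFin n)
  ∙ encodeList (λ L → encodeSubset L ∙ encodeℕ (b L)) 𝓛
  where
  open CBGT G
  open LaminarMatroid M

-- On the given input, A outputs the encodings of π 0, π 1, … one by one,
-- using at most T steps for preprocessing and at most T for each next set.

Implements : ∀ {n} → Algorithm → Tree → Schedule n → ℕ → Set
Implements A input π T =
  Σ[ state ∈ (ℕ → Tree) ]
             (preprocess ∶ input ⇓ state zero within T)
           × (∀ t → step ∶ state t ⇓ encodeSubset (π t) ∙ state (suc t) within T)
  where open Algorithm A

{-# OPTIONS --safe #-}

-- Let F k be the set of elements with 2 ^ k * g e > 1, and let K be large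
-- enough for F K to contain all elements with positive rate.  On day t start
-- with S = F K and, for j = K - 1, ..., 0, keep all elements of S in F j and
-- every other of the remaining ones, along a fixed order of E; bit j of t
-- decides whether the first or the second one is kept.  Finally cut S.
--
-- In the order every set L of the family is contiguous, so halving keeps at
-- most half of the remaining elements of L, rounded up.  If an element that
-- is in F k but not in F (k - 1) counts 2 ^ (j - k) (and 1 if j < k) at level
-- j, the total load of S ∩ L thus stays below 2 ^ j * b L: this holds for F j
-- since g is a convex combination of independent sets, and rounding does no
-- harm because 2 ^ (j + 1) * b L is even.  At level 0 it says that S is
-- independent.
--
-- Both halves of a window of 2 ^ (j + 1) days get one of the two halves of S,
-- so an element whose least level is k is cut in every aligned window of
-- w = 2 ^ k days.  Its height is therefore at most (2 * w - 1) * g e, and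
-- w * g e ≤ 2.

module Submission where

open import Defs
open import Data.Integer using (+_)
open import Data.Nat using (ℕ; _*_; _^_)
open import Data.Product using (Σ-syntax; _×_)
open import Data.Rational using (_/_)

open import Data.Bool using (Bool; true; false; not; if_then_else_; T; _∧_; _xor_)
open import Data.Digit using (Bit; toDigits; fromDigits)
open import Data.Empty using (⊥-elim)
open import Data.Fin using (Fin; zero; suc; toℕ)
open import Data.Fin.Properties using (toℕ<n)
open import Data.Fin.Subset using (Subset; inside; outside; _∈_; _∩_; ⊥; ∣_∣)
open import Data.Fin.Subset.Properties using (_∈?_; x∈p∩q⁺; ∉⊥)
import Data.Integer as ℤ
import Data.Integer.Properties as ℤ
open import Data.List using
  ( List; []; _∷_; _∷ʳ_; _++_; _ʳ++_; allFin; drop; filter; foldl; foldr; length; map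
  ; replicate; reverse; tabulate)
open import Data.List.Membership.Propositional using () renaming (_∈_ to _∈ˡ_)
open import Data.List.Membership.Propositional.Properties
  using (∈-allFin; ∈-filter⁻; ∈-map⁺; ∈-map⁻)
open import Data.List.Properties using
  ( drop-all; length-drop; length-map; length-reverse; length-tabulate; length-ʳ++; map-id
  ; map-tabulate; map-∘; reverse-involutive; unfold-reverse)
open import Data.List.Relation.Binary.Permutation.Propositional as Perm
  using (_↭_; ↭-prep; ↭-refl; ↭-sym; ↭-trans)
open import Data.List.Relation.Binary.Permutation.Propositional.Properties
  using (shift; ∈-resp-↭; ↭-length; ↭-reverse)
open import Data.List.Relation.Unary.All as All using (All; []; _∷_)
import Data.List.Relation.Unary.All.Properties as All
open import Data.List.Relation.Unary.Any using (here; there)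
open import Data.Nat using
  (zero; suc; _+_; _∸_; _≤_; _<_; _≤?_; z≤n; s≤s; NonZero)
open import Data.Nat.Coprimality as Coprime using (1-coprimeTo)
open import Data.Nat.DivMod as ℕ using (_%_; m%n<n; m≡m%n+[m/n]*n)
open import Data.Nat.ListAction using (sum)
open import Data.Nat.Properties
open import Data.Nat.Tactic.RingSolver using (solve-∀)
open import Data.Product using (∃-syntax; _,_; proj₁; proj₂)
open import Data.Rational as ℚ using (ℚ; mkℚ; 0ℚ; 1ℚ; ↥_; ↧ₙ_; *≤*; *<*)
import Data.Rational.Properties as ℚ
open import Data.Rational.Solver using (module +-*-Solver)
open import Data.Rational.Unnormalised as ℚᵘ using (*≡*)
import Data.Rational.Unnormalised.Properties as ℚᵘ
open import Data.Sum as Sum using (_⊎_; inj₁; inj₂)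
open import Data.Vec using ([]; _∷_; lookup; toList; _[_]≔_)
open import Data.Vec.Properties using
  (length-toList; lookup∘updateAt; lookup⇒[]=; toList-replicate; []=⇒lookup)
open import Function using (_∘_; id)
open import Function.Bundles using (module Equivalence)
open import Relation.Binary.PropositionalEquality using
  (_≡_; refl; sym; trans; cong; cong₂; subst; module ≡-Reasoning)
open import Relation.Nullary using (¬_; does; yes; no)

-- Polynomial running-time bounds for programs

-- An upper bound for the running time of P, provided that no loop is
-- repeated more than N times.

cost : Prog → ℕ → ℕ
cost skip         N = 1
cost nil          N = 1
cost hd           N = 1
cost tl           N = 1
cost ⟨ P , Q ⟩    N = suc (cost P N + cost Q N)
cost (P ⨾ Q)      N = suc (cost P N + cost Q N)
cost (cond B P Q) N = suc (cost B N + (cost P N + cost Q N))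
cost (while B P)  N = suc (cost B N) + N * suc (cost B N + cost P N)

-- `N` is nonzero so that `N ^ d` is monotone in `d`; this lets `+-poly` raise two bounds to a
-- common degree.
PolynomiallyBounded : (ℕ → ℕ) → Set
PolynomiallyBounded f = ∃[ c ] ∃[ d ] (∀ N → .{{NonZero N}} → f N ≤ c * N ^ d)

const-poly : ∀ k → PolynomiallyBounded (λ _ → k)
const-poly k = k , 0 , λ N → ≤-reflexive (sym (*-identityʳ k))

id-poly : PolynomiallyBounded (λ N → N)
id-poly = 1 , 1 , λ N → ≤-reflexive (sym (trans (*-identityˡ (N ^ 1)) (*-identityʳ N)))

+-poly : ∀ {f g} → PolynomiallyBounded f → PolynomiallyBounded g →
         PolynomiallyBounded (λ N → f N + g N)
+-poly {f} {g} (c , d , p) (c′ , d′ , q) = c + c′ , d + d′ , λ N → begin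
  f N + g N                            ≤⟨ +-mono-≤ (p N) (q N) ⟩
  c * N ^ d + c′ * N ^ d′
    ≤⟨ +-mono-≤ (*-monoʳ-≤ c (^-monoʳ-≤ N (m≤m+n d d′)))
                (*-monoʳ-≤ c′ (^-monoʳ-≤ N (m≤n+m d′ d))) ⟩
  c * N ^ (d + d′) + c′ * N ^ (d + d′) ≡⟨ *-distribʳ-+ (N ^ (d + d′)) c c′ ⟨
  (c + c′) * N ^ (d + d′)              ∎
  where open ≤-Reasoning

*-poly : ∀ {f g} → PolynomiallyBounded f → PolynomiallyBounded g →
         PolynomiallyBounded (λ N → f N * g N)
*-poly {f} {g} (c , d , p) (c′ , d′ , q) = c * c′ , d + d′ , λ N → begin
  f N * g N                   ≤⟨ *-mono-≤ (p N) (q N) ⟩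
  (c * N ^ d) * (c′ * N ^ d′) ≡⟨ interchange c (N ^ d) c′ (N ^ d′) ⟩
  c * c′ * (N ^ d * N ^ d′)   ≡⟨ cong (c * c′ *_) (^-distribˡ-+-* N d d′) ⟨
  c * c′ * N ^ (d + d′)       ∎
  where
  open ≤-Reasoning
  interchange : ∀ w x y z → (w * x) * (y * z) ≡ w * y * (x * z)
  interchange = solve-∀

-- A single `N` bounds the repetitions of every loop, so for a fixed program `cost` is composed of
-- constants, `N`, sums and products.
cost-poly : ∀ P → PolynomiallyBounded (cost P)
cost-poly skip         = const-poly 1
cost-poly nil          = const-poly 1
cost-poly hd           = const-poly 1
cost-poly tl           = const-poly 1
cost-poly ⟨ P , Q ⟩    = +-poly (const-poly 1) (+-poly (cost-poly P) (cost-poly Q))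
cost-poly (P ⨾ Q)      = +-poly (const-poly 1) (+-poly (cost-poly P) (cost-poly Q))
cost-poly (cond B P Q) =
  +-poly (const-poly 1) (+-poly (cost-poly B) (+-poly (cost-poly P) (cost-poly Q)))
cost-poly (while B P)  =
  +-poly (+-poly (const-poly 1) (cost-poly B))
         (*-poly id-poly (+-poly (const-poly 1) (+-poly (cost-poly B) (cost-poly P))))

infix 3 _∶_⇓_⟪_⟫

-- A record, so that N can be inferred.
record _∶_⇓_⟪_⟫ (P : Prog) (x y : Tree) (N : ℕ) : Set where
  constructor bounded
  field
    {steps} : ℕ
    steps≤  : steps ≤ cost P N
    run     : P ∶ x ⇓ y [ steps ]

infixr 4 _⨾⇓_

_⨾⇓_ : ∀ {P Q x y z N} → P ∶ x ⇓ y ⟪ N ⟫ → Q ∶ y ⇓ z ⟪ N ⟫ → P ⨾ Q ∶ x ⇓ z ⟪ N ⟫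
bounded k≤ p ⨾⇓ bounded l≤ q = bounded (s≤s (+-mono-≤ k≤ l≤)) (⇓seq p q)

⟨_,_⟩⇓ : ∀ {P Q x y z N} → P ∶ x ⇓ y ⟪ N ⟫ → Q ∶ x ⇓ z ⟪ N ⟫ →
         ⟨ P , Q ⟩ ∶ x ⇓ y ∙ z ⟪ N ⟫
⟨ bounded k≤ p , bounded l≤ q ⟩⇓ = bounded (s≤s (+-mono-≤ k≤ l≤)) (⇓pair p q)

then⇓ : ∀ {B P Q x u v y N} → B ∶ x ⇓ u ∙ v ⟪ N ⟫ → P ∶ x ⇓ y ⟪ N ⟫ → cond B P Q ∶ x ⇓ y ⟪ N ⟫
then⇓ (bounded k≤ p) (bounded l≤ q) =
  bounded (s≤s (+-mono-≤ k≤ (≤-trans l≤ (m≤m+n _ _)))) (⇓then p q)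

else⇓ : ∀ {B P Q x y N} → B ∶ x ⇓ nil ⟪ N ⟫ → Q ∶ x ⇓ y ⟪ N ⟫ → cond B P Q ∶ x ⇓ y ⟪ N ⟫
else⇓ {P = P} {N = N} (bounded k≤ p) (bounded l≤ q) =
  bounded (s≤s (+-mono-≤ k≤ (≤-trans l≤ (m≤n+m _ (cost P N))))) (⇓else p q)

-- Execution of loop-free programs

loopFree : Prog → Bool
loopFree skip         = true
loopFree nil          = true
loopFree hd           = true
loopFree tl           = true
loopFree ⟨ P , Q ⟩    = loopFree P ∧ loopFree Q
loopFree (P ⨾ Q)      = loopFree P ∧ loopFree Q
loopFree (cond B P Q) = loopFree B ∧ loopFree P ∧ loopFree Q
loopFree (while B P)  = false

head tail : Tree → Tree
head nil     = nil
head (x ∙ _) = x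
tail nil     = nil
tail (_ ∙ y) = y

branch : Tree → Tree → Tree → Tree
branch nil     y z = z
branch (_ ∙ _) y z = y

eval : Prog → Tree → Tree
eval skip         x = x
eval nil          x = nil
eval hd           x = head x
eval tl           x = tail x
eval ⟨ P , Q ⟩    x = eval P x ∙ eval Q x
eval (P ⨾ Q)      x = eval Q (eval P x)
eval (cond B P Q) x = branch (eval B x) (eval P x) (eval Q x)
-- A placeholder value: `eval⇓` speaks of loop-free programs.
eval (while B P)  x = x

T-∧₁ : ∀ {a b} → T (a ∧ b) → T a
T-∧₁ {true} _ = _

T-∧₂ : ∀ {a b} → T (a ∧ b) → T b
T-∧₂ {true} t = t

-- For a concrete loop-free `P` the type `T (loopFree P)` reduces to the unit type, so the hidden
-- argument is filled in and the run is found by computation.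
eval⇓ : ∀ P {x N} {_ : T (loopFree P)} → P ∶ x ⇓ eval P x ⟪ N ⟫
eval⇓ skip = bounded ≤-refl ⇓skip
eval⇓ nil  = bounded ≤-refl ⇓nil
eval⇓ hd {nil}   = bounded ≤-refl ⇓hd-nil
eval⇓ hd {_ ∙ _} = bounded ≤-refl ⇓hd
eval⇓ tl {nil}   = bounded ≤-refl ⇓tl-nil
eval⇓ tl {_ ∙ _} = bounded ≤-refl ⇓tl
eval⇓ ⟨ P , Q ⟩ {_} {_} {t} = ⟨ eval⇓ P {_} {_} {T-∧₁ t} , eval⇓ Q {_} {_} {T-∧₂ {loopFree P} t} ⟩⇓
eval⇓ (P ⨾ Q) {_} {_} {t} = eval⇓ P {_} {_} {T-∧₁ t} ⨾⇓ eval⇓ Q {_} {_} {T-∧₂ {loopFree P} t}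
eval⇓ (cond B P Q) {x} {N} {t} with eval B x | eval⇓ B {x} {N} {T-∧₁ t}
... | nil   | p = else⇓ p (eval⇓ Q {x} {N} {T-∧₂ {loopFree P} (T-∧₂ {loopFree B} t)})
... | _ ∙ _ | p = then⇓ p (eval⇓ P {x} {N} {T-∧₁ (T-∧₂ {loopFree B} t)})

-- Iteration along encoded lists

-- A left fold: each P turns xs ∙ s into the final accumulator, where P
-- turns x ∙ s into the next one.

each : Prog → Prog
each P = while hd ⟨ hd ⨾ tl , ⟨ hd ⨾ hd , tl ⟩ ⨾ P ⟩ ⨾ tl

module _ {A : Set} (P : Prog) (N : ℕ) (enc : A → Tree) where

  -- The trace of a fold, with one bounded run of `P` per element. Correctness proofs build the
  -- trace by recursion on the list and leave the loop and its cost to `each⇓`.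
  data Iterate : Tree → List A → Tree → Set where
    []  : ∀ {s} → Iterate s [] s
    _∷_ : ∀ {x xs s s′ s″} → P ∶ enc x ∙ s ⇓ s′ ⟪ N ⟫ → Iterate s′ xs s″ →
          Iterate s (x ∷ xs) s″

  infixl 5 _∷ʳ⇓_
  -- Extension at the end serves `levels⇓`, where the bits are read in reverse.
  _∷ʳ⇓_ : ∀ {xs x s s′ s″} → Iterate s xs s′ → P ∶ enc x ∙ s′ ⇓ s″ ⟪ N ⟫ →
          Iterate s (xs ∷ʳ x) s″
  []       ∷ʳ⇓ q = q ∷ []
  (p ∷ ps) ∷ʳ⇓ q = p ∷ (ps ∷ʳ⇓ q)

  private
    body : Prog
    body = ⟨ hd ⨾ tl , ⟨ hd ⨾ hd , tl ⟩ ⨾ P ⟩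

    loop⇓ : ∀ {s xs s′} → Iterate s xs s′ →
            while hd body ∶ encodeList enc xs ∙ s ⇓ nil ∙ s′
              within 2 + length xs * suc (1 + cost body N)
    loop⇓ [] = 2 , ≤-refl , ⇓stop ⇓hd
    loop⇓ (_∷_ {x} {xs} p ps)
      with bounded {k} k≤ q ← ⟨ eval⇓ (hd ⨾ tl) , eval⇓ ⟨ hd ⨾ hd , tl ⟩ ⨾⇓ p ⟩⇓
         | m , m≤ , qs ← loop⇓ ps =
      suc (1 + k + m) , (begin
        suc (1 + k + m)
          ≤⟨ s≤s (s≤s (+-mono-≤ k≤ m≤)) ⟩
        2 + (cost body N + (2 + length xs * suc (1 + cost body N)))
          ≡⟨ rearrange (cost body N) (length xs * suc (1 + cost body N)) ⟩
        2 + (suc (1 + cost body N) + length xs * suc (1 + cost body N)) ∎)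
      , ⇓loop ⇓hd q qs
      where
      open ≤-Reasoning
      rearrange : ∀ c r → 2 + (c + (2 + r)) ≡ 2 + (suc (1 + c) + r)
      rearrange = solve-∀

  each⇓ : ∀ {s xs s′} → length xs ≤ N → Iterate s xs s′ →
          each P ∶ encodeList enc xs ∙ s ⇓ s′ ⟪ N ⟫
  each⇓ len≤N ps with k , k≤ , q ← loop⇓ ps =
    bounded (≤-trans k≤ (s≤s (s≤s (*-monoˡ-≤ (suc (1 + cost body N)) len≤N)))) q ⨾⇓ eval⇓ tl

-- The body of a fold receives `x ∙ s`. When `s` encodes a list, this already is that list with `x`
-- pushed, so `skip` is the right body for reversal.
reverse⇓ : ∀ {A : Set} {enc : A → Tree} {N} xs {ys} → length xs ≤ N →
           each skip ∶ encodeList enc xs ∙ encodeList enc ys ⇓ encodeList enc (xs ʳ++ ys) ⟪ N ⟫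
reverse⇓ {enc = enc} {N} xs len≤N = each⇓ _ _ _ len≤N (go xs)
  where
  go : ∀ xs {ys} → Iterate skip N enc (encodeList enc ys) xs (encodeList enc (xs ʳ++ ys))
  go []       = []
  go (x ∷ xs) = eval⇓ skip ∷ go xs

-- Orders in which the sets of a laminar family are contiguous

false≢true : ∀ {A : Set} {b} → b ≡ false → b ≡ true → A
false≢true refl ()

module _ {A : Set} where

  Inside Outside : (A → Bool) → List A → Set
  Inside  p = All (λ x → p x ≡ true)
  Outside p = All (λ x → p x ≡ false)

  data Initial (p : A → Bool) : List A → Set where
    outside : ∀ {xs} → Outside p xs → Initial p xs
    in∷     : ∀ {x xs} → p x ≡ true → Initial p xs → Initial p (x ∷ xs)

  data Contiguous (p : A → Bool) : List A → Set where
    initial : ∀ {xs} → Initial p xs → Contiguous p xs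
    out∷    : ∀ {x xs} → p x ≡ false → Contiguous p xs → Contiguous p (x ∷ xs)

  Inside-++-Initial : ∀ {p xs ys} → Inside p xs → Initial p ys → Initial p (xs ++ ys)
  Inside-++-Initial []         q = q
  Inside-++-Initial (px ∷ pxs) q = in∷ px (Inside-++-Initial pxs q)

  Outside-++-Contiguous : ∀ {p xs ys} → Outside p xs → Contiguous p ys → Contiguous p (xs ++ ys)
  Outside-++-Contiguous []         q = q
  Outside-++-Contiguous (px ∷ pxs) q = out∷ px (Outside-++-Contiguous pxs q)

  Initial-++-Outside : ∀ {p xs ys} → Initial p xs → Outside p ys → Initial p (xs ++ ys)
  Initial-++-Outside (outside o) q = outside (All.++⁺ o q)
  Initial-++-Outside (in∷ px i)  q = in∷ px (Initial-++-Outside i q)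

  Contiguous-++-Outside : ∀ {p xs ys} → Contiguous p xs → Outside p ys → Contiguous p (xs ++ ys)
  Contiguous-++-Outside (initial i) q = initial (Initial-++-Outside i q)
  Contiguous-++-Outside (out∷ px c) q = out∷ px (Contiguous-++-Outside c q)

  select : (A → Bool) → List A → List A
  select p []       = []
  select p (x ∷ xs) = if p x then x ∷ select p xs else select p xs

  All-select : ∀ {P : A → Set} p xs → (∀ {x} → p x ≡ true → P x) → All P (select p xs)
  All-select p []       f = []
  All-select p (x ∷ xs) f with p x in px
  ... | true  = f px ∷ All-select p xs f
  ... | false = All-select p xs f

  select⁺ : ∀ {P : A → Set} p {xs} → All P xs → All P (select p xs)
  select⁺ p []                 = []
  select⁺ p (_∷_ {x} px pxs) with p x
  ... | true  = px ∷ select⁺ p pxs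
  ... | false = select⁺ p pxs

  select-Initial : ∀ {q} p {xs} → Initial q xs → Initial q (select p xs)
  select-Initial p (outside o) = outside (select⁺ p o)
  select-Initial p (in∷ {x} qx i) with p x
  ... | true  = in∷ qx (select-Initial p i)
  ... | false = select-Initial p i

  select-Contiguous : ∀ {q} p {xs} → Contiguous q xs → Contiguous q (select p xs)
  select-Contiguous p (initial i) = initial (select-Initial p i)
  select-Contiguous p (out∷ {x} qx c) with p x
  ... | true  = out∷ qx (select-Contiguous p c)
  ... | false = select-Contiguous p c

  _⊑_ _#_ : (A → Bool) → (A → Bool) → Set
  p ⊑ q = ∀ {x} → p x ≡ true → q x ≡ true
  p # q = ∀ {x} → p x ≡ true → q x ≡ false

  Laminar : (A → Bool) → (A → Bool) → Set
  Laminar p q = p ⊑ q ⊎ q ⊑ p ⊎ p # q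

  -- Collecting at the first member of `p`, rather than at the front of the list, keeps larger sets
  -- contiguous that were gathered earlier.
  gather : (A → Bool) → List A → List A
  gather p []       = []
  gather p (x ∷ xs) with p x
  ... | true  = x ∷ (select p xs ++ select (λ y → not (p y)) xs)
  ... | false = x ∷ gather p xs

  select-partition : ∀ p xs → select p xs ++ select (λ y → not (p y)) xs ↭ xs
  select-partition p []       = ↭-refl
  select-partition p (x ∷ xs) with p x
  ... | true  = ↭-prep x (select-partition p xs)
  ... | false = ↭-trans (shift x (select p xs) _) (↭-prep x (select-partition p xs))

  gather-↭ : ∀ p xs → gather p xs ↭ xs
  gather-↭ p []       = ↭-refl
  gather-↭ p (x ∷ xs) with p x
  ... | true  = ↭-prep x (select-partition p xs)
  ... | false = ↭-prep x (gather-↭ p xs)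

  private
    not-true : ∀ {b} → not b ≡ true → b ≡ false
    not-true {false} _ = refl

    ⊑-contra : ∀ {p q : A → Bool} → p ⊑ q → ∀ {x} → q x ≡ false → p x ≡ false
    ⊑-contra {p} p⊑q {x} qx with p x in px
    ... | false = refl
    ... | true  = false≢true qx (p⊑q px)

  gather-gathers : ∀ p xs → Contiguous p (gather p xs)
  gather-gathers p []       = initial (outside [])
  gather-gathers p (x ∷ xs) with p x in px
  ... | true  = initial (in∷ px (Inside-++-Initial (All-select p xs λ e → e)
                                  (outside (All-select (λ y → not (p y)) xs not-true))))
  ... | false = out∷ px (gather-gathers p xs)

  gather-All : ∀ {P : A → Set} p {xs} → All P xs → All P (gather p xs)
  gather-All p []               = []
  gather-All p (_∷_ {x} px pxs) with p x
  ... | true  = px ∷ All.++⁺ (select⁺ p pxs) (select⁺ _ pxs)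
  ... | false = px ∷ gather-All p pxs

  gather-Initial : ∀ p q → p ⊑ q ⊎ p # q → ∀ {xs} → Initial q xs → Initial q (gather p xs)
  gather-Initial p q _ (outside o) = outside (gather-All p o)
  gather-Initial p q h (in∷ {x} {xs} qx i) with p x in px
  gather-Initial p q h (in∷ qx i) | false = in∷ qx (gather-Initial p q h i)
  gather-Initial p q (inj₁ p⊑q) (in∷ {x} {xs} qx i) | true =
    in∷ qx (Inside-++-Initial (All-select p xs p⊑q) (select-Initial _ i))
  gather-Initial p q (inj₂ p#q) (in∷ qx i) | true = false≢true (p#q px) qx

  -- If `p` lies in `q`, elements move only within the block of `q`. If `q` lies in `p`, the
  -- selected part contains the block of `q` and the rest avoids `q`. If they are disjoint, the
  -- first member of `p` sits before or after the block of `q`, so the collected elements do not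
  -- split it.
  gather-Contiguous : ∀ p q → Laminar p q → ∀ {xs} → Contiguous q xs → Contiguous q (gather p xs)
  gather-Contiguous p q _ {[]} c = c
  gather-Contiguous p q lam {x ∷ xs} c with p x in px
  gather-Contiguous p q lam (out∷ qx c) | false = out∷ qx (gather-Contiguous p q lam c)
  gather-Contiguous p q lam (initial (outside (qx ∷ o))) | false =
    initial (outside (qx ∷ gather-All p o))
  gather-Contiguous p q (inj₁ p⊑q) (initial (in∷ qx i)) | false =
    initial (in∷ qx (gather-Initial p q (inj₁ p⊑q) i))
  gather-Contiguous p q (inj₂ (inj₂ p#q)) (initial (in∷ qx i)) | false =
    initial (in∷ qx (gather-Initial p q (inj₂ p#q) i))
  gather-Contiguous p q (inj₂ (inj₁ q⊑p)) (initial (in∷ qx i)) | false = false≢true px (q⊑p qx)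
  gather-Contiguous p q (inj₁ p⊑q) {x ∷ xs} c | true = initial (in∷ (p⊑q px)
    (Inside-++-Initial (All-select p xs p⊑q) (select-Initial _ (after (p⊑q px) c))))
    where
    after : ∀ {x xs} → q x ≡ true → Contiguous q (x ∷ xs) → Initial q xs
    after qx (initial (outside (_ ∷ o))) = outside o
    after qx (initial (in∷ _ i))         = i
    after qx (out∷ ¬qx _)                = false≢true ¬qx qx
  gather-Contiguous p q (inj₂ (inj₁ q⊑p)) {x ∷ xs} c | true =
    Contiguous-++-Outside (subst (Contiguous q) (select-true px) (select-Contiguous p c))
      (All-select (λ y → not (p y)) xs λ e → ⊑-contra {q} {p} q⊑p (not-true e))
    where
    select-true : p x ≡ true → select p (x ∷ xs) ≡ x ∷ select p xs
    select-true px rewrite px = refl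
  gather-Contiguous p q (inj₂ (inj₂ p#q)) {x ∷ xs} c | true = out∷ (p#q px)
    (Outside-++-Contiguous (All-select p xs p#q) (select-Contiguous _ (after (p#q px) c)))
    where
    after : ∀ {x xs} → q x ≡ false → Contiguous q (x ∷ xs) → Contiguous q xs
    after qx (initial (outside (_ ∷ o))) = initial (outside o)
    after qx (initial (in∷ ¬qx i))       = false≢true qx ¬qx
    after qx (out∷ _ c)                  = c

  gatherAll : List (A → Bool) → List A → List A
  gatherAll ps xs = foldl (λ ys p → gather p ys) xs ps

  gatherAll-↭ : ∀ ps xs → gatherAll ps xs ↭ xs
  gatherAll-↭ []       xs = ↭-refl
  gatherAll-↭ (p ∷ ps) xs = ↭-trans (gatherAll-↭ ps (gather p xs)) (gather-↭ p xs)

  gatherAll-preserves : ∀ {q} ps {xs} → All (λ p → Laminar p q) ps →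
                        Contiguous q xs → Contiguous q (gatherAll ps xs)
  gatherAll-preserves []       []           c = c
  gatherAll-preserves (p ∷ ps) (lam ∷ lams) c =
    gatherAll-preserves ps lams (gather-Contiguous p _ lam c)

  -- A set becomes contiguous when it is gathered itself and remains so while later sets are
  -- gathered. Hence the family may come in any order.
  gatherAll-Contiguous : ∀ ps {xs q} → (∀ {p} → p ∈ˡ ps → Laminar p q) → q ∈ˡ ps →
                         Contiguous q (gatherAll ps xs)
  gatherAll-Contiguous (p ∷ ps) {xs} lam (here refl) =
    gatherAll-preserves ps (All.tabulate λ p∈ → lam (there p∈)) (gather-gathers p xs)
  gatherAll-Contiguous (p ∷ ps) lam (there q∈) =
    gatherAll-Contiguous ps (λ p∈ → lam (there p∈)) q∈

  -- gather in one pass; the elements before, in and after the block are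
  -- stacked in us, vs and ws.

  Stacks : Set
  Stacks = List A × List A × List A

  gatherStep : (A → Bool) → A → Stacks → Stacks
  gatherStep p x (us , vs , ws) with p x | vs
  ... | true  | _     = us , x ∷ vs , ws
  ... | false | []    = x ∷ us , vs , ws
  ... | false | _ ∷ _ = us , vs , x ∷ ws

  gatherLoop : (A → Bool) → List A → Stacks → Stacks
  gatherLoop p xs s = foldl (λ s x → gatherStep p x s) s xs

  unstack : Stacks → List A
  unstack (us , vs , ws) = us ʳ++ (vs ʳ++ (ws ʳ++ []))

  -- A nonempty middle stack records that the block has begun; from then on nonmembers go to the
  -- third stack.
  unstack-block : ∀ p xs us v vs ws →
                  unstack (gatherLoop p xs (us , v ∷ vs , ws)) ≡
                  us ʳ++ (v ∷ vs) ʳ++ (select p xs ++ (ws ʳ++ select (λ y → not (p y)) xs))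
  unstack-block p []       us v vs ws = refl
  unstack-block p (x ∷ xs) us v vs ws with p x
  ... | true  = unstack-block p xs us x (v ∷ vs) ws
  ... | false = unstack-block p xs us v vs (x ∷ ws)

  unstack-gatherLoop : ∀ p xs us → unstack (gatherLoop p xs (us , [] , [])) ≡ us ʳ++ gather p xs
  unstack-gatherLoop p []       us = refl
  unstack-gatherLoop p (x ∷ xs) us with p x
  ... | true  = unstack-block p xs us x [] []
  ... | false = unstack-gatherLoop p xs (x ∷ us)

-- The selection of the set of a day

bit : Bool → ℕ
bit b = if b then 1 else 0

bit≤1 : ∀ b → bit b ≤ 1
bit≤1 false = z≤n
bit≤1 true  = s≤s z≤n

-- Counters are lists of bits, least significant bit first.

increment : Bool → List Bool → List Bool
-- The last carry is dropped, so a counter of `K` bits works modulo `2 ^ K`.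
increment c []       = []
increment c (b ∷ bs) = (b xor c) ∷ increment (b ∧ c) bs

counter : ℕ → ℕ → List Bool
counter K zero    = replicate K false
counter K (suc t) = increment true (counter K t)

length-increment : ∀ c bs → length (increment c bs) ≡ length bs
length-increment c []       = refl
length-increment c (b ∷ bs) = cong suc (length-increment (b ∧ c) bs)

length-counter : ∀ K t → length (counter K t) ≡ K
length-counter zero    zero    = refl
length-counter (suc K) zero    = cong suc (length-counter K zero)
length-counter K       (suc t) = trans (length-increment true (counter K t)) (length-counter K t)

increment-false : ∀ bs → increment false bs ≡ bs
increment-false []           = refl
increment-false (false ∷ bs) = cong (false ∷_) (increment-false bs)
increment-false (true ∷ bs)  = cong (true ∷_) (increment-false bs)

counter-even : ∀ K t → counter (suc K) (t + t) ≡ false ∷ counter K t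
counter-odd  : ∀ K t → counter (suc K) (suc (t + t)) ≡ true ∷ counter K t
counter-even K zero    = refl
counter-even K (suc t) rewrite +-suc t t = cong (increment true) (counter-odd K t)
counter-odd K t = trans (cong (increment true) (counter-even K t))
                        (cong (true ∷_) (increment-false (counter K t)))

-- Valid for every `t`, since overflow is dropped on both sides. It lets `window` prescribe the
-- lowest bit of a day without disturbing the higher ones.
counter-bit : ∀ K b t → counter (suc K) (bit b + 2 * t) ≡ b ∷ counter K t
counter-bit K b t rewrite +-identityʳ t with b
... | false = counter-even K t
... | true  = counter-odd K t

module Selection {A : Set} (F : ℕ → A → Bool)
                 (F-mono : ∀ j {e} → F j e ≡ true → F (suc j) e ≡ true) where

  -- The elements flagged true form a set of which the elements outside F j
  -- are halved: every other one is kept, the first one iff τ.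

  halve : ℕ → Bool → List (A × Bool) → List (A × Bool)
  halve j τ []             = []
  halve j τ ((e , c) ∷ xs) with F j e | c
  ... | true  | _     = (e , true)  ∷ halve j τ xs
  ... | false | true  = (e , τ)     ∷ halve j (not τ) xs
  ... | false | false = (e , false) ∷ halve j τ xs

  -- The bits belong to the levels `j`, `j + 1` and so on, and the highest level is halved first.
  -- The level at which the bits run out is the top one.
  halveAt : ℕ → List A → List Bool → List (A × Bool)
  halveAt j es []       = map (λ e → e , F j e) es
  halveAt j es (b ∷ bs) = halve j b (halveAt (suc j) es bs)

  halve-proj₁ : ∀ j τ xs → map proj₁ (halve j τ xs) ≡ map proj₁ xs
  halve-proj₁ j τ []             = refl
  halve-proj₁ j τ ((e , c) ∷ xs) with F j e | c
  ... | true  | _     = cong (e ∷_) (halve-proj₁ j τ xs)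
  ... | false | true  = cong (e ∷_) (halve-proj₁ j (not τ) xs)
  ... | false | false = cong (e ∷_) (halve-proj₁ j τ xs)

  halveAt-proj₁ : ∀ j es bs → map proj₁ (halveAt j es bs) ≡ es
  halveAt-proj₁ j es []       = trans (sym (map-∘ es)) (map-id es)
  halveAt-proj₁ j es (b ∷ bs) = trans (halve-proj₁ j b (halveAt (suc j) es bs)) (halveAt-proj₁ (suc j) es bs)

  length-halveAt : ∀ j es bs → length (halveAt j es bs) ≡ length es
  length-halveAt j es bs =
    trans (sym (length-map proj₁ (halveAt j es bs))) (cong length (halveAt-proj₁ j es bs))

  -- 2 ^ (j ∸ k), where k is the least level with F k e (or ∞).

  weight : ℕ → A → ℕ
  weight zero    e = 1
  weight (suc j) e = if F j e then 2 * weight j e else 1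

  load : ℕ → (A → Bool) → List (A × Bool) → ℕ
  load j p []             = 0
  load j p ((e , c) ∷ xs) = (if c ∧ p e then weight j e else 0) + load j p xs

  Covers : ℕ → List (A × Bool) → Set
  Covers j = All (λ (e , c) → F j e ≡ true → c ≡ true)

  halve-Covers : ∀ j τ xs → Covers j (halve j τ xs)
  halve-Covers j τ []             = []
  halve-Covers j τ ((e , c) ∷ xs) with F j e in Fe | c
  ... | true  | _     = (λ _ → refl) ∷ halve-Covers j τ xs
  ... | false | true  = (λ Fe′ → false≢true Fe Fe′) ∷ halve-Covers j (not τ) xs
  ... | false | false = (λ Fe′ → trans (sym Fe) Fe′) ∷ halve-Covers j τ xs

  halveAt-Covers : ∀ j es bs → Covers j (halveAt j es bs)
  halveAt-Covers j es []       = All.map⁺ (All.tabulate λ _ Fe → Fe)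
  halveAt-Covers j es (b ∷ bs) = halve-Covers j b (halveAt (suc j) es bs)

  -- By monotonicity such an element is outside all lower levels as well, so no doubling has begun.
  weight≡1 : ∀ j e → F j e ≡ false → weight j e ≡ 1
  weight≡1 zero    e ¬F = refl
  weight≡1 (suc j) e ¬F with F j e in Fe
  ... | true  = false≢true ¬F (F-mono j Fe)
  ... | false = refl

  halve-load-Outside : ∀ j p τ xs → Outside p (map proj₁ xs) → load j p (halve j τ xs) ≡ 0
  halve-load-Outside j p τ []             []        = refl
  halve-load-Outside j p τ ((e , c) ∷ xs) (¬pe ∷ o) with F j e | c | τ
  ... | true  | _     | _     rewrite ¬pe = halve-load-Outside j p _ xs o
  ... | false | true  | false = halve-load-Outside j p _ xs o
  ... | false | true  | true  rewrite ¬pe = halve-load-Outside j p _ xs o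
  ... | false | false | _     = halve-load-Outside j p _ xs o

  -- An element of `F j` doubles its weight from level `j` to `suc j`, so it adds the same to both
  -- sides. The other elements weigh 1 at both levels and are kept alternately: twice the number
  -- kept exceeds their number by at most one, and only if the first is kept. This is the surplus
  -- `bit τ`.
  halve-load-Initial : ∀ j p τ xs → Covers (suc j) xs → Initial p (map proj₁ xs) →
                       2 * load j p (halve j τ xs) ≤ bit τ + load (suc j) p xs
  halve-load-Initial j p τ [] _ _ = z≤n
  halve-load-Initial j p τ xs@(_ ∷ _) _ (outside o) rewrite halve-load-Outside j p τ xs o = z≤n
  halve-load-Initial j p τ ((e , c) ∷ xs) (ce ∷ cov) (in∷ pe i) with F j e in Fe | c in c≡
  ... | true | false = false≢true refl (ce (F-mono j Fe))
  ... | true | true rewrite pe = begin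
    2 * (weight j e + load j p (halve j τ xs))      ≡⟨ *-distribˡ-+ 2 (weight j e) _ ⟩
    2 * weight j e + 2 * load j p (halve j τ xs)
      ≤⟨ +-monoʳ-≤ (2 * weight j e) (halve-load-Initial j p τ xs cov i) ⟩
    2 * weight j e + (bit τ + load (suc j) p xs)    ≡⟨ rearrange (2 * weight j e) (bit τ) _ ⟩
    bit τ + (2 * weight j e + load (suc j) p xs)    ∎
    where
    open ≤-Reasoning
    rearrange : ∀ x y z → x + (y + z) ≡ y + (x + z)
    rearrange = solve-∀
  ... | false | false = halve-load-Initial j p τ xs cov i
  halve-load-Initial j p false ((e , c) ∷ xs) (ce ∷ cov) (in∷ pe i) | false | true
    rewrite pe = halve-load-Initial j p true xs cov i
  halve-load-Initial j p true ((e , c) ∷ xs) (ce ∷ cov) (in∷ pe i) | false | true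
    rewrite pe | weight≡1 j e Fe = begin
    2 * (1 + load j p (halve j false xs))   ≡⟨ *-distribˡ-+ 2 1 _ ⟩
    2 + 2 * load j p (halve j false xs)     ≤⟨ +-monoʳ-≤ 2 (halve-load-Initial j p false xs cov i) ⟩
    2 + load (suc j) p xs                   ∎
    where open ≤-Reasoning

  -- Elements before the block only affect the phase in which the block is entered. In either phase
  -- the surplus is at most 1.
  halve-load : ∀ j p τ xs → Covers (suc j) xs → Contiguous p (map proj₁ xs) →
               2 * load j p (halve j τ xs) ≤ 1 + load (suc j) p xs
  halve-load j p τ [] _ _ = z≤n
  halve-load j p τ xs@(_ ∷ _) cov (initial i) =
    ≤-trans (halve-load-Initial j p τ xs cov i) (+-monoˡ-≤ _ (bit≤1 τ))
  halve-load j p τ ((e , c) ∷ xs) (_ ∷ cov) (out∷ ¬pe con) with F j e | c | τ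
  ... | true  | true  | _     rewrite ¬pe = halve-load j p _ xs cov con
  ... | true  | false | _     rewrite ¬pe = halve-load j p _ xs cov con
  ... | false | true  | false rewrite ¬pe = halve-load j p _ xs cov con
  ... | false | true  | true  rewrite ¬pe = halve-load j p _ xs cov con
  ... | false | false | _     = halve-load j p _ xs cov con

  halveAt-load : ∀ p es c → Contiguous p es →
                 (∀ j → load j p (map (λ e → e , F j e) es) ≤ 2 ^ j * c) →
                 ∀ j bs → load j p (halveAt j es bs) ≤ 2 ^ j * c
  halveAt-load p es c con base j []       = base j
  halveAt-load p es c con base j (b ∷ bs) = halves _ _ (begin
    2 * load j p (halve j b xs)  ≤⟨ halve-load j p b xs (halveAt-Covers (suc j) es bs)
                                      (subst (Contiguous p) (sym (halveAt-proj₁ (suc j) es bs)) con) ⟩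
    1 + load (suc j) p xs        ≤⟨ +-monoʳ-≤ 1 (halveAt-load p es c con base (suc j) bs) ⟩
    1 + 2 ^ suc j * c            ≡⟨ cong suc (*-assoc 2 (2 ^ j) c) ⟩
    1 + 2 * (2 ^ j * c)          ∎)
    where
    open ≤-Reasoning
    xs = halveAt (suc j) es bs
    -- Here parity absorbs the surplus of 1.
    halves : ∀ m n → 2 * m ≤ 1 + 2 * n → m ≤ n
    halves m n le with m ≤? n
    ... | yes m≤n = m≤n
    ... | no  m≰n = ⊥-elim (<-irrefl refl (begin-strict
      1 + 2 * n <⟨ n<1+n _ ⟩
      2 + 2 * n ≡⟨ *-distribˡ-+ 2 1 n ⟨
      2 * suc n ≤⟨ *-monoʳ-≤ 2 (≰⇒> m≰n) ⟩
      2 * m     ≤⟨ le ⟩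
      1 + 2 * n ∎))

  halve-F : ∀ {e} j τ xs → F j e ≡ true → e ∈ˡ map proj₁ xs → (e , true) ∈ˡ halve j τ xs
  halve-F {e} j τ ((e , c) ∷ xs) Fe (here refl) with F j e | Fe
  ... | true | _ = here refl
  halve-F j τ ((e′ , c) ∷ xs) Fe (there e∈) with F j e′ | c
  ... | true  | _     = there (halve-F j τ xs Fe e∈)
  ... | false | true  = there (halve-F j (not τ) xs Fe e∈)
  ... | false | false = there (halve-F j τ xs Fe e∈)

  halveAt-F : ∀ {e} j es bs → F j e ≡ true → e ∈ˡ es → (e , true) ∈ˡ halveAt j es bs
  halveAt-F {e} j es []       Fe e∈ = subst (λ c → (e , c) ∈ˡ map (λ e → e , F j e) es) Fe (∈-map⁺ (λ e → e , F j e) e∈)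
  halveAt-F {e} j es (b ∷ bs) Fe e∈ =
    halve-F j b _ Fe (subst (e ∈ˡ_) (sym (halveAt-proj₁ (suc j) es bs)) e∈)

  -- The selections for `τ` and `not τ` are complementary outside `F j`, and both contain all of
  -- `F j`.
  halve-keeps : ∀ {e} j τ xs → (e , true) ∈ˡ xs →
                (e , true) ∈ˡ halve j τ xs ⊎ (e , true) ∈ˡ halve j (not τ) xs
  halve-keeps j τ ((e , .true) ∷ xs) (here refl) with F j e | τ
  ... | true  | _     = inj₁ (here refl)
  ... | false | true  = inj₁ (here refl)
  ... | false | false = inj₂ (here refl)
  halve-keeps j τ ((e′ , c) ∷ xs) (there e∈) with F j e′ | c
  ... | true  | _     = Sum.map there there (halve-keeps j τ xs e∈)
  ... | false | true  = Sum.map there there (halve-keeps j (not τ) xs e∈)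
  ... | false | false = Sum.map there there (halve-keeps j τ xs e∈)

  halve-keeps-some : ∀ {e} j xs → (e , true) ∈ˡ xs → ∃[ b ] (e , true) ∈ˡ halve j b xs
  halve-keeps-some j xs e∈ with halve-keeps j false xs e∈
  ... | inj₁ e∈′ = false , e∈′
  ... | inj₂ e∈′ = true  , e∈′

  -- Induction on the distance `i` from level `j` up to `κ`. The set at level `suc j` depends only
  -- on the higher bits of the day, so both values of the lowest bit halve the same set and one of
  -- them keeps `e`; the offset in the window becomes `bit b + 2 * r`. At level `κ` itself `e` is
  -- kept every day. The `m` bits above are fixed by the number of the window.
  window : ∀ {e es} κ → F κ e ≡ true → e ∈ˡ es → ∀ i j m q → j + i ≡ κ →
           ∃[ r ] r < 2 ^ i × (e , true) ∈ˡ halveAt j es (counter (i + m) (q * 2 ^ i + r))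
  window {e} {es} κ Fe e∈ zero j m q refl =
    0 , s≤s z≤n , halveAt-F j es (counter m (q * 1 + 0)) (subst (λ κ → F κ e ≡ true) (+-identityʳ j) Fe) e∈
  window {e} {es} κ Fe e∈ (suc i) j m q eq
    with r , r< , e∈′ ← window κ Fe e∈ i (suc j) m q (trans (sym (+-suc j i)) eq)
    with b , e∈″ ← halve-keeps-some j _ e∈′ =
      bit b + 2 * r , r<′ b , subst (λ bs → (e , true) ∈ˡ halveAt j es bs) (sym counter≡) e∈″
    where
    open ≡-Reasoning
    rearrange : ∀ q w x y → q * (2 * w) + (x + 2 * y) ≡ x + 2 * (q * w + y)
    rearrange = solve-∀
    counter≡ : counter (suc i + m) (q * 2 ^ suc i + (bit b + 2 * r)) ≡
               b ∷ counter (i + m) (q * 2 ^ i + r)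
    counter≡ = trans (cong (counter (suc i + m)) (rearrange q (2 ^ i) (bit b) r))
                     (counter-bit (i + m) b (q * 2 ^ i + r))
    r<′ : ∀ b → bit b + 2 * r < 2 ^ suc i
    r<′ false = *-monoʳ-< 2 r<
    r<′ true  = ≤-trans (≤-reflexive (sym (*-distribˡ-+ 2 1 r))) (*-monoʳ-≤ 2 r<)

-- Rational bounds

-- Given directly in lowest terms, so that numerator and denominator reduce and order proofs can be
-- matched on.
ι : ℕ → ℚ
ι m = mkℚ (+ m) 0 (Coprime.sym (1-coprimeTo m))

ι-+ : ∀ m n → ι (m + n) ≡ ι m ℚ.+ ι n
ι-+ m n = ℚ.toℚᵘ-injective (ℚᵘ.≃-sym (ℚᵘ.≃-trans (ℚ.toℚᵘ-homo-+ (ι m) (ι n)) (*≡* (cong (ℤ._* (+ 1)) (begin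
  + m ℤ.* + 1 ℤ.+ + n ℤ.* + 1 ≡⟨ cong₂ ℤ._+_ (ℤ.*-identityʳ (+ m)) (ℤ.*-identityʳ (+ n)) ⟩
  + m ℤ.+ + n                 ≡⟨ ℤ.pos-+ m n ⟨
  + (m + n)                   ∎)))))
  where open ≡-Reasoning

ι-* : ∀ m n → ι (m * n) ≡ ι m ℚ.* ι n
ι-* m n = ℚ.toℚᵘ-injective (ℚᵘ.≃-sym (ℚᵘ.≃-trans (ℚ.toℚᵘ-homo-* (ι m) (ι n))
  (*≡* (cong (ℤ._* (+ 1)) (sym (ℤ.pos-* m n))))))

ι-mono : ∀ {m n} → m ≤ n → ι m ℚ.≤ ι n
ι-mono m≤n = *≤* (ℤ.*-monoʳ-≤-nonNeg (+ 1) (ℤ.+≤+ m≤n))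

ι-cancel : ∀ {m n} → ι m ℚ.≤ ι n → m ≤ n
ι-cancel {m} {n} (*≤* le) = ℤ.drop‿+≤+ (ℤ.*-cancelʳ-≤-pos (+ m) (+ n) (+ 1) le)

1≤ι* : ∀ m {q} → 0ℚ ℚ.≤ q → ↧ₙ q < m * ℤ.∣ ↥ q ∣ → 1ℚ ℚ.≤ ι m ℚ.* q
1≤ι* m {q@(mkℚ (+ a) d-1 _)} _ lt = ℚ.toℚᵘ-cancel-≤ (ℚᵘ.≤-respʳ-≃ (ℚᵘ.≃-sym (ℚ.toℚᵘ-homo-* (ι m) q))
  (ℚᵘ.*≤* (begin
    + 1 ℤ.* + suc (d-1 + 0)    ≡⟨ ℤ.*-identityˡ _ ⟩
    + suc (d-1 + 0)            ≤⟨ ℤ.+≤+ (≤-trans (≤-reflexive (cong suc (+-identityʳ d-1))) (<⇒≤ lt)) ⟩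
    + (m * a)                  ≡⟨ ℤ.pos-* m a ⟩
    + m ℤ.* + a                ≡⟨ ℤ.*-identityʳ _ ⟨
    + m ℤ.* + a ℤ.* + 1        ∎)))
  where open ℤ.≤-Reasoning
1≤ι* m {mkℚ ℤ.-[1+ _ ] _ _} (*≤* ()) _

ι*≤1 : ∀ m {q} → 0ℚ ℚ.≤ q → m * ℤ.∣ ↥ q ∣ ≤ ↧ₙ q → ι m ℚ.* q ℚ.≤ 1ℚ
ι*≤1 m {q@(mkℚ (+ a) d-1 _)} _ le = ℚ.toℚᵘ-cancel-≤ (ℚᵘ.≤-respˡ-≃ (ℚᵘ.≃-sym (ℚ.toℚᵘ-homo-* (ι m) q))
  (ℚᵘ.*≤* (begin
    + m ℤ.* + a ℤ.* + 1        ≡⟨ ℤ.*-identityʳ _ ⟩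
    + m ℤ.* + a                ≡⟨ ℤ.pos-* m a ⟨
    + (m * a)                  ≤⟨ ℤ.+≤+ (≤-trans le (≤-reflexive (sym (cong suc (+-identityʳ d-1))))) ⟩
    + suc (d-1 + 0)            ≡⟨ ℤ.*-identityˡ _ ⟨
    + 1 ℤ.* + suc (d-1 + 0)    ∎)))
  where open ℤ.≤-Reasoning
ι*≤1 m {mkℚ ℤ.-[1+ _ ] _ _} (*≤* ()) _

-- Finite sums and the averaged rank bound

∑-cong : ∀ {A : Set} (xs : List A) {f g : A → ℚ} → (∀ x → f x ≡ g x) → ∑ xs f ≡ ∑ xs g
∑-cong []       eq = refl
∑-cong (x ∷ xs) eq = cong₂ ℚ._+_ (eq x) (∑-cong xs eq)

∑-mono : ∀ {A : Set} (xs : List A) {f g : A → ℚ} → (∀ x → f x ℚ.≤ g x) → ∑ xs f ℚ.≤ ∑ xs g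
∑-mono []       le = ℚ.≤-refl
∑-mono (x ∷ xs) le = ℚ.+-mono-≤ (le x) (∑-mono xs le)

∑-zero : ∀ {A : Set} (xs : List A) → ∑ xs (λ _ → 0ℚ) ≡ 0ℚ
∑-zero []       = refl
∑-zero (x ∷ xs) = trans (ℚ.+-identityˡ _) (∑-zero xs)

∑-+ : ∀ {A : Set} (xs : List A) f g → ∑ xs (λ x → f x ℚ.+ g x) ≡ ∑ xs f ℚ.+ ∑ xs g
∑-+ []       f g = refl
∑-+ (x ∷ xs) f g = trans (cong (f x ℚ.+ g x ℚ.+_) (∑-+ xs f g)) (interchange (f x) (g x) (∑ xs f) (∑ xs g))
  where
  open +-*-Solver
  interchange : ∀ a b c d → (a ℚ.+ b) ℚ.+ (c ℚ.+ d) ≡ (a ℚ.+ c) ℚ.+ (b ℚ.+ d)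
  interchange = solve 4 (λ a b c d → (a :+ b) :+ (c :+ d) := (a :+ c) :+ (b :+ d)) refl

∑-distribˡ : ∀ {A : Set} (xs : List A) q f → ∑ xs (λ x → q ℚ.* f x) ≡ q ℚ.* ∑ xs f
∑-distribˡ []       q f = sym (ℚ.*-zeroʳ q)
∑-distribˡ (x ∷ xs) q f = trans (cong (q ℚ.* f x ℚ.+_) (∑-distribˡ xs q f)) (sym (ℚ.*-distribˡ-+ q (f x) _))

∑-↭ : ∀ {A : Set} {xs ys : List A} (f : A → ℚ) → xs ↭ ys → ∑ xs f ≡ ∑ ys f
∑-↭ f Perm.refl          = refl
∑-↭ f (Perm.prep x p)    = cong (f x ℚ.+_) (∑-↭ f p)
∑-↭ f (Perm.swap {xs} {ys} x y p) = trans (cong (λ s → f x ℚ.+ (f y ℚ.+ s)) (∑-↭ f p)) (exchange (f x) (f y) (∑ ys f))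
  where
  open +-*-Solver
  exchange : ∀ a b c → a ℚ.+ (b ℚ.+ c) ≡ b ℚ.+ (a ℚ.+ c)
  exchange = solve 3 (λ a b c → a :+ (b :+ c) := b :+ (a :+ c)) refl
∑-↭ f (Perm.trans p q)   = trans (∑-↭ f p) (∑-↭ f q)

∑-allFin-suc : ∀ {n} (f : Fin (suc n) → ℚ) → ∑ (allFin (suc n)) f ≡ f zero ℚ.+ ∑ (allFin n) (f ∘ suc)
∑-allFin-suc f = cong (λ xs → f zero ℚ.+ foldr ℚ._+_ 0ℚ xs)
  (trans (map-tabulate suc f) (sym (map-tabulate id (f ∘ suc))))

infixr 8 [_]_

[_]_ : Bool → ℚ → ℚ
[ b ] q = if b then q else 0ℚ

[]-+ : ∀ b p q → [ b ] (p ℚ.+ q) ≡ [ b ] p ℚ.+ [ b ] q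
[]-+ false p q = refl
[]-+ true  p q = refl

∑-∩ : ∀ {n} (I L : Subset n) q →
      ∑ (allFin n) (λ e → [ lookup L e ] [ lookup I e ] q) ≡ q ℚ.* ι ∣ I ∩ L ∣
∑-∩ []      []      q = sym (ℚ.*-zeroʳ q)
∑-∩ (i ∷ I) (l ∷ L) q = trans (∑-allFin-suc (λ e → [ lookup (l ∷ L) e ] [ lookup (i ∷ I) e ] q))
  (trans (cong ([ l ] [ i ] q ℚ.+_) (∑-∩ I L q)) (count i l))
  where
  count : ∀ i l → [ l ] [ i ] q ℚ.+ q ℚ.* ι ∣ I ∩ L ∣ ≡ q ℚ.* ι ∣ (i ∷ I) ∩ (l ∷ L) ∣
  count false false = ℚ.+-identityˡ _
  count false true  = ℚ.+-identityˡ _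
  count true  false = ℚ.+-identityˡ _
  count true  true  = trans (trans (cong (ℚ._+ q ℚ.* ι ∣ I ∩ L ∣) (sym (ℚ.*-identityʳ q)))
                        (sym (ℚ.*-distribˡ-+ q 1ℚ (ι ∣ I ∩ L ∣))))
                      (cong (q ℚ.*_) (sym (ι-+ 1 ∣ I ∩ L ∣)))

does-∈? : ∀ {n} (e : Fin n) I → does (e ∈? I) ≡ lookup I e
does-∈? zero    (inside ∷ I)  = refl
does-∈? zero    (outside ∷ I) = refl
does-∈? (suc e) (_ ∷ I)       = does-∈? e I

∑-filter-∈ : ∀ {n} (e : Fin n) Is f →
             ∑ (filter (e ∈?_) Is) f ≡ ∑ Is (λ I → [ lookup I e ] f I)
∑-filter-∈ e []       f = refl
∑-filter-∈ e (I ∷ Is) f rewrite sym (does-∈? e I) with does (e ∈? I)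
... | true  = cong (f I ℚ.+_) (∑-filter-∈ e Is f)
... | false = trans (∑-filter-∈ e Is f) (sym (ℚ.+-identityˡ _))

∑-filter-≤ : ∀ {n} (e : Fin n) Is f → (∀ {I} → I ∈ˡ Is → 0ℚ ℚ.≤ f I) →
             ∑ (filter (e ∈?_) Is) f ℚ.≤ ∑ Is f
∑-filter-≤ e []       f pos = ℚ.≤-refl
∑-filter-≤ e (I ∷ Is) f pos with does (e ∈? I)
... | true  = ℚ.+-monoʳ-≤ (f I) (∑-filter-≤ e Is f (pos ∘ there))
... | false = ℚ.≤-trans (ℚ.≤-reflexive (sym (ℚ.+-identityˡ _)))
                        (ℚ.+-mono-≤ (pos (here refl)) (∑-filter-≤ e Is f (pos ∘ there)))

-- Double counting: after exchanging the sums, each `I` contributes `f I` times `∣ I ∩ L ∣`, which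
-- is at most `f I` times `b`.
∑-weighted-rank : ∀ {n} (L : Subset n) b Is (f : Subset n → ℚ) →
                  (∀ {I} → I ∈ˡ Is → 0ℚ ℚ.≤ f I) → (∀ {I} → I ∈ˡ Is → ∣ I ∩ L ∣ ≤ b) →
                  ∑ (allFin n) (λ e → [ lookup L e ] ∑ Is (λ I → [ lookup I e ] f I)) ℚ.≤ ∑ Is f ℚ.* ι b
∑-weighted-rank {n} L b [] f _ _ = ℚ.≤-reflexive (trans
  (trans (∑-cong (allFin n) (λ e → if-same (lookup L e))) (∑-zero (allFin n))) (sym (ℚ.*-zeroˡ (ι b))))
  where
  if-same : ∀ c → [ c ] 0ℚ ≡ 0ℚ
  if-same false = refl
  if-same true  = refl
∑-weighted-rank {n} L b (I ∷ Is) f pos rank = begin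
  ∑ E (λ e → [ lookup L e ] ([ lookup I e ] f I ℚ.+ ∑ Is (λ I → [ lookup I e ] f I)))
    ≡⟨ ∑-cong E (λ e → []-+ (lookup L e) _ _) ⟩
  ∑ E (λ e → [ lookup L e ] [ lookup I e ] f I ℚ.+ [ lookup L e ] ∑ Is (λ I → [ lookup I e ] f I))
    ≡⟨ ∑-+ E _ _ ⟩
  ∑ E (λ e → [ lookup L e ] [ lookup I e ] f I) ℚ.+
  ∑ E (λ e → [ lookup L e ] ∑ Is (λ I → [ lookup I e ] f I))
    ≡⟨ cong (ℚ._+ ∑ E (λ e → [ lookup L e ] ∑ Is (λ I → [ lookup I e ] f I))) (∑-∩ I L (f I)) ⟩
  f I ℚ.* ι ∣ I ∩ L ∣ ℚ.+ ∑ E (λ e → [ lookup L e ] ∑ Is (λ I → [ lookup I e ] f I))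
    ≤⟨ ℚ.+-mono-≤ (ℚ.*-monoˡ-≤-nonNeg (f I) {{ℚ.nonNegative (pos (here refl))}} (ι-mono (rank (here refl))))
                  (∑-weighted-rank L b Is f (pos ∘ there) (rank ∘ there)) ⟩
  f I ℚ.* ι b ℚ.+ ∑ Is f ℚ.* ι b
    ≡⟨ ℚ.*-distribʳ-+ (ι b) (f I) (∑ Is f) ⟨
  (f I ℚ.+ ∑ Is f) ℚ.* ι b ∎
  where
  open ℚ.≤-Reasoning
  E = allFin n

-- Heights and the gaps between cuts

age : ∀ {n} → Schedule n → Fin n → ℕ → ℕ
age π e zero    = 0
age π e (suc t) = if lookup (π t) e then 0 else suc (age π e t)

-- Heights are taken after growing, so at age 0 the height is already `g e`.
height-age : ∀ {n} (G : CBGT n) π t e → heightOn G π t e ≡ ι (suc (age π e t)) ℚ.* CBGT.g G e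
height-age G π zero    e = sym (ℚ.*-identityˡ _)
height-age G π (suc t) e rewrite does-∈? e (π t) with lookup (π t) e
... | true  = sym (ℚ.*-identityˡ _)
... | false = trans (cong (ℚ._+ g e) (height-age G π t e)) (begin
  ι k ℚ.* g e ℚ.+ g e           ≡⟨ cong (ι k ℚ.* g e ℚ.+_) (ℚ.*-identityˡ (g e)) ⟨
  ι k ℚ.* g e ℚ.+ 1ℚ ℚ.* g e    ≡⟨ ℚ.*-distribʳ-+ (g e) (ι k) 1ℚ ⟨
  (ι k ℚ.+ ι 1) ℚ.* g e         ≡⟨ cong (ℚ._* g e) (trans (sym (ι-+ k 1)) (cong ι (+-comm k 1))) ⟩
  ι (suc k) ℚ.* g e             ∎)
  where
  open CBGT G
  open ≡-Reasoning
  k = suc (age π e t)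

age≤ : ∀ {n} (π : Schedule n) e t → age π e t ≤ t
age≤ π e zero    = z≤n
age≤ π e (suc t) with lookup (π t) e
... | true  = z≤n
... | false = s≤s (age≤ π e t)

age-after-cut : ∀ {n} (π : Schedule n) e s k → lookup (π s) e ≡ true → age π e (suc k + s) ≤ k
age-after-cut π e s zero    cut rewrite cut = z≤n
age-after-cut π e s (suc k) cut with lookup (π (suc k + s)) e
... | true  = z≤n
... | false = s≤s (age-after-cut π e s k cut)

-- At worst the cut falls on the first day of the previous window and the current day is the last of
-- its own. These are `2 * w - 1` days apart, which makes the age `2 * w - 2`.
age-windows : ∀ {n} (π : Schedule n) e w → .{{NonZero w}} →
              (∀ q → ∃[ r ] r < w × lookup (π (q * w + r)) e ≡ true) →
              ∀ t → 2 + age π e t ≤ 2 * w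
age-windows π e w cuts t = subst (λ t → 2 + age π e t ≤ 2 * w)
  (trans (+-comm (t ℕ./ w * w) (t % w)) (sym (m≡m%n+[m/n]*n t w))) (go (t ℕ./ w) (t % w) (m%n<n t w))
  where
  open ≤-Reasoning
  go : ∀ q i → i < w → 2 + age π e (q * w + i) ≤ 2 * w
  -- In the first window there may have been no cut yet, but the age is at most the number of days
  -- elapsed.
  go zero i i<w = begin
    2 + age π e i  ≤⟨ +-monoʳ-≤ 2 (age≤ π e i) ⟩
    1 + suc i      ≤⟨ +-mono-≤ (≤-trans (s≤s z≤n) i<w) i<w ⟩
    w + w          ≡⟨ cong (λ v → w + v) (+-identityʳ w) ⟨
    2 * w          ∎
  go (suc q) i i<w with r , r<w , cut ← cuts q = begin
    2 + age π e (w + q * w + i)            ≡⟨ cong (λ t → 2 + age π e t) days ⟨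
    2 + age π e (suc k + (q * w + r))      ≤⟨ +-monoʳ-≤ 2 (age-after-cut π e (q * w + r) k cut) ⟩
    2 + k                                  ≡⟨⟩
    suc (suc (w ∸ suc r + i))              ≡⟨ +-suc (suc (w ∸ suc r)) i ⟨
    suc (w ∸ suc r) + suc i                ≤⟨ +-mono-≤ (∸-monoʳ-< {w} (s≤s z≤n) r<w) i<w ⟩
    w + w                                  ≡⟨ cong (λ v → w + v) (+-identityʳ w) ⟨
    2 * w                                  ∎
    where
    -- The current day comes `suc k` days after the cut in the previous window.
    k = w ∸ suc r + i
    days : suc k + (q * w + r) ≡ w + q * w + i
    days = trans (rearrange (w ∸ suc r) i (q * w) r) (cong (λ v → v + q * w + i) (m∸n+n≡m r<w))
      where
      rearrange : ∀ a i x r → suc (a + i) + (x + r) ≡ a + suc r + x + i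
      rearrange = solve-∀

-- Binary numbers, least significant bit first

value : List Bool → ℕ
value []       = 0
value (b ∷ bs) = bit b + 2 * value bs

isOne : Bit → Bool
isOne zero    = false
isOne (suc _) = true

opaque
  -- Opaque, so that outside this block it is known only through its value and its encoding, and
  -- `toDigits` is never unfolded.
  binary : ℕ → List Bool
  binary m = map isOne (proj₁ (toDigits 2 m))

  value-binary : ∀ m → value (binary m) ≡ m
  value-binary m = trans (go (proj₁ (toDigits 2 m))) (proj₂ (toDigits 2 m))
    where
    go : ∀ ds → value (map isOne ds) ≡ fromDigits ds
    go []              = refl
    go (zero ∷ ds)     = trans (cong (2 *_) (go ds)) (*-comm 2 (fromDigits ds))
    go (suc zero ∷ ds) = cong suc (trans (cong (2 *_) (go ds)) (*-comm 2 (fromDigits ds)))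

  encodeℕ-binary : ∀ m → encodeℕ m ≡ encodeList encodeBool (binary m)
  encodeℕ-binary m = go (proj₁ (toDigits 2 m))
    where
    go : ∀ ds → encodeList encodeBit ds ≡ encodeList encodeBool (map isOne ds)
    go []           = refl
    go (zero ∷ ds)  = cong (nil ∙_) (go ds)
    go (suc _ ∷ ds) = cong ((nil ∙ nil) ∙_) (go ds)

lsb : List Bool → Bool
lsb []      = false
lsb (b ∷ _) = b

value-lsb : ∀ bs → value bs ≡ bit (lsb bs) + 2 * value (drop 1 bs)
value-lsb []       = refl
value-lsb (b ∷ bs) = refl

compareBit : Bool → Bool → Bool → Bool
compareBit true  true  r = r
compareBit true  false r = true
compareBit false true  r = false
compareBit false false r = r

compareZero : Bool → List Bool → Bool
compareZero r []       = r
compareZero r (y ∷ ys) = compareZero (compareBit false y r) ys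

-- The flag r tells how the bits that were already read compare.

compare : Bool → List Bool → List Bool → Bool
compare r []       ys = compareZero r ys
compare r (x ∷ xs) ys = compare (compareBit x (lsb ys) r) xs (drop 1 ys)

Exceeds : Bool → ℕ → ℕ → Set
Exceeds true  m n = n < m
Exceeds false m n = m ≤ n

-- The flag acts as one unit added on the left: if the lower bits of the left number are the larger
-- ones, `m ≥ n` suffices for the higher parts, that is, `m + 1 > n`. The tables check that this
-- unit is carried correctly through one more bit.
Exceeds-step : ∀ c x y r {m n} → Exceeds c (m + bit (compareBit x y r)) n →
               Exceeds c (bit x + 2 * m + bit r) (bit y + 2 * n)
Exceeds-step true x y r {m} {n} n<m = +-cancelˡ-≤ 1 _ _ (begin
  1 + suc (bit y + 2 * n)                  ≡⟨ rearrange (bit y) n ⟩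
  2 * suc n + bit y                        ≤⟨ +-monoˡ-≤ (bit y) (*-monoʳ-≤ 2 n<m) ⟩
  2 * (m + bit (compareBit x y r)) + bit y ≡⟨ rearrange′ m (bit (compareBit x y r)) (bit y) ⟩
  2 * m + (2 * bit (compareBit x y r) + bit y) ≤⟨ +-monoʳ-≤ (2 * m) (table x y r) ⟩
  2 * m + (1 + (bit x + bit r))            ≡⟨ rearrange″ (bit x) m (bit r) ⟩
  1 + (bit x + 2 * m + bit r)              ∎)
  where
  open ≤-Reasoning
  rearrange : ∀ y n → 1 + suc (y + 2 * n) ≡ 2 * suc n + y
  rearrange = solve-∀
  rearrange′ : ∀ m c y → 2 * (m + c) + y ≡ 2 * m + (2 * c + y)
  rearrange′ = solve-∀
  rearrange″ : ∀ x m r → 2 * m + (1 + (x + r)) ≡ 1 + (x + 2 * m + r)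
  rearrange″ = solve-∀
  table : ∀ x y r → 2 * bit (compareBit x y r) + bit y ≤ 1 + (bit x + bit r)
  table true  true  true  = ≤-refl
  table true  true  false = m≤n+m 1 1
  table true  false true  = m≤n+m 2 1
  table true  false false = ≤-refl
  table false true  true  = m≤n+m 1 1
  table false true  false = ≤-refl
  table false false true  = ≤-refl
  table false false false = z≤n
Exceeds-step false x y r {m} {n} m≤n = begin
  bit x + 2 * m + bit r                        ≡⟨ rearrange (bit x) m (bit r) ⟩
  2 * m + (bit x + bit r)                      ≤⟨ +-monoʳ-≤ (2 * m) (table x y r) ⟩
  2 * m + (bit y + 2 * bit (compareBit x y r)) ≡⟨ rearrange′ m (bit y) (bit (compareBit x y r)) ⟩
  bit y + 2 * (m + bit (compareBit x y r))     ≤⟨ +-monoʳ-≤ (bit y) (*-monoʳ-≤ 2 m≤n) ⟩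
  bit y + 2 * n                                ∎
  where
  open ≤-Reasoning
  rearrange : ∀ x m r → x + 2 * m + r ≡ 2 * m + (x + r)
  rearrange = solve-∀
  rearrange′ : ∀ m y c → 2 * m + (y + 2 * c) ≡ y + 2 * (m + c)
  rearrange′ = solve-∀
  table : ∀ x y r → bit x + bit r ≤ bit y + 2 * bit (compareBit x y r)
  table true  true  true  = m≤n+m 2 1
  table true  true  false = ≤-refl
  table true  false true  = ≤-refl
  table true  false false = m≤n+m 1 1
  table false true  true  = ≤-refl
  table false true  false = z≤n
  table false false true  = m≤n+m 1 1
  table false false false = z≤n

Exceeds-compareZero : ∀ r ys → Exceeds (compareZero r ys) (bit r) (value ys)
Exceeds-compareZero false []       = z≤n
Exceeds-compareZero true  []       = s≤s z≤n
Exceeds-compareZero r     (y ∷ ys) =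
  Exceeds-step _ false y r {0} (Exceeds-compareZero (compareBit false y r) ys)

Exceeds-compare : ∀ r xs ys → Exceeds (compare r xs ys) (value xs + bit r) (value ys)
Exceeds-compare r []       ys = Exceeds-compareZero r ys
Exceeds-compare r (x ∷ xs) ys rewrite value-lsb ys =
  Exceeds-step _ x (lsb ys) r (Exceeds-compare (compareBit x (lsb ys) r) xs (drop 1 ys))

value-drop≥ : ∀ k bs → 2 ^ k * value (drop k bs) ≤ value bs
value-drop≥ zero    bs       = ≤-reflexive (+-identityʳ _)
value-drop≥ (suc k) []       = ≤-reflexive (*-zeroʳ (2 ^ suc k))
value-drop≥ (suc k) (b ∷ bs) = begin
  2 * 2 ^ k * value (drop k bs)   ≡⟨ *-assoc 2 (2 ^ k) _ ⟩
  2 * (2 ^ k * value (drop k bs)) ≤⟨ *-monoʳ-≤ 2 (value-drop≥ k bs) ⟩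
  2 * value bs                    ≤⟨ m≤n+m _ (bit b) ⟩
  bit b + 2 * value bs            ∎
  where open ≤-Reasoning

value-drop< : ∀ k bs → value bs < 2 ^ k * suc (value (drop k bs))
value-drop< zero    bs = ≤-reflexive (sym (+-identityʳ _))
value-drop< (suc k) [] = ≤-trans (m^n>0 2 (suc k)) (≤-reflexive (sym (*-identityʳ _)))
value-drop< (suc k) (b ∷ bs) = begin
  suc (bit b + 2 * value bs)          ≤⟨ s≤s (+-monoˡ-≤ _ (bit≤1 b)) ⟩
  2 + 2 * value bs                    ≡⟨ *-distribˡ-+ 2 1 (value bs) ⟨
  2 * suc (value bs)                  ≤⟨ *-monoʳ-≤ 2 (value-drop< k bs) ⟩
  2 * (2 ^ k * suc (value (drop k bs))) ≡⟨ *-assoc 2 (2 ^ k) _ ⟨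
  2 * 2 ^ k * suc (value (drop k bs)) ∎
  where
  open ≤-Reasoning

-- Dropping `k` bits divides by `2 ^ k`, rounding down. An integer is larger than the rounded
-- quotient exactly if `2 ^ k` times it is larger than the dividend, so the test needs no
-- multiplication.
exceeds : ℕ → List Bool → List Bool → Bool
exceeds k as ds = compare false as (drop k ds)

Exceeds-exceeds : ∀ k as ds → Exceeds (exceeds k as ds) (2 ^ k * value as) (value ds)
Exceeds-exceeds k as ds
  with exceeds k as ds | subst (λ a → Exceeds (exceeds k as ds) a (value (drop k ds)))
                               (+-identityʳ (value as)) (Exceeds-compare false as (drop k ds))
... | true  | v<a = ≤-trans (value-drop< k ds) (*-monoʳ-≤ (2 ^ k) v<a)
... | false | a≤v = ≤-trans (*-monoʳ-≤ (2 ^ k) a≤v) (value-drop≥ k ds)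

exceeds-mono : ∀ k as ds → exceeds k as ds ≡ true → exceeds (suc k) as ds ≡ true
exceeds-mono k as ds e
  with exceeds (suc k) as ds | Exceeds-exceeds (suc k) as ds
     | subst (λ b → Exceeds b _ _) e (Exceeds-exceeds k as ds)
... | true  | _    | _    = refl
... | false | 2a≤d | d<a  = ⊥-elim (<-irrefl refl (≤-trans d<a
  (≤-trans (*-monoˡ-≤ (value as) (m≤m+n (2 ^ k) _)) 2a≤d)))

-- All bits of `ds` are dropped, so the test compares `value as` with 0. Hence a level at least the
-- length of a denominator detects a positive rate.
exceeds-all : ∀ k as ds → length ds ≤ k → exceeds k as ds ≡ false → value as ≡ 0
exceeds-all k as ds len e rewrite drop-all k ds len =
  n≤0⇒n≡0 (≤-trans (≤-reflexive (sym (+-identityʳ _)))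
                   (subst (λ b → Exceeds b (value as + 0) 0) e (Exceeds-compare false as [])))

-- Sets built by insertion, and a common bound over a finite set

cutInto : ∀ {n} → Subset n → List (Fin n × Bool) → Subset n
cutInto S []             = S
cutInto S ((e , c) ∷ xs) = cutInto (if c then S [ e ]≔ inside else S) xs

-- Only an inequality, because `e` may already belong to `S`.
∣insert∩∣ : ∀ {n} (S L : Subset n) e → ∣ (S [ e ]≔ inside) ∩ L ∣ ≤ bit (lookup L e) + ∣ S ∩ L ∣
∣insert∩∣ (outside ∷ S) (outside ∷ L) zero = ≤-refl
∣insert∩∣ (outside ∷ S) (inside ∷ L)  zero = ≤-refl
∣insert∩∣ (inside ∷ S)  (outside ∷ L) zero = ≤-refl
∣insert∩∣ (inside ∷ S)  (inside ∷ L)  zero = m≤n+m _ 1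
∣insert∩∣ (outside ∷ S) (l ∷ L)       (suc e) = ∣insert∩∣ S L e
∣insert∩∣ (inside ∷ S)  (outside ∷ L) (suc e) = ∣insert∩∣ S L e
∣insert∩∣ (inside ∷ S)  (inside ∷ L)  (suc e) =
  ≤-trans (s≤s (∣insert∩∣ S L e)) (≤-reflexive (sym (+-suc (bit (lookup L e)) _)))

∣⊥∩∣ : ∀ {n} (L : Subset n) → ∣ ⊥ ∩ L ∣ ≡ 0
∣⊥∩∣ []      = refl
∣⊥∩∣ (l ∷ L) = ∣⊥∩∣ L

lookup-insert : ∀ {n} (S : Subset n) e e′ → lookup S e ≡ true → lookup (S [ e′ ]≔ inside) e ≡ true
lookup-insert (s ∷ S) zero    zero     _ = refl
lookup-insert (s ∷ S) zero    (suc e′) h = h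
lookup-insert (s ∷ S) (suc e) zero     h = h
lookup-insert (s ∷ S) (suc e) (suc e′) h = lookup-insert S e e′ h

cutInto-keeps : ∀ {n} (S : Subset n) xs e → lookup S e ≡ true → lookup (cutInto S xs) e ≡ true
cutInto-keeps S []                 e h = h
cutInto-keeps S ((e′ , true) ∷ xs) e h = cutInto-keeps _ xs e (lookup-insert S e e′ h)
cutInto-keeps S ((e′ , false) ∷ xs) e h = cutInto-keeps S xs e h

cutInto-∈ : ∀ {n} (S : Subset n) xs {e} → (e , true) ∈ˡ xs → lookup (cutInto S xs) e ≡ true
cutInto-∈ S ((e , .true) ∷ xs) (here refl) = cutInto-keeps _ xs e (lookup∘updateAt e S)
cutInto-∈ S ((_ , c) ∷ xs) (there e∈) = cutInto-∈ _ xs e∈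

-- The maximum of finitely many bounds below `c` is below `c`. Positivity of `c` supplies the bound
-- for the empty ground set.
∃-bound : ∀ {n} c (P : Fin n → ℚ → Set) → (∀ {e p q} → p ℚ.≤ q → P e p → P e q) → 0ℚ ℚ.< c →
          (∀ e → ∃[ q ] q ℚ.< c × P e q) → ∃[ q ] q ℚ.< c × (∀ e → P e q)
∃-bound {zero}  c P mono 0<c each = 0ℚ , 0<c , λ ()
∃-bound {suc n} c P mono 0<c each
  with p , p<c , Pp ← each zero | q , q<c , Pq ← ∃-bound c (P ∘ suc) mono 0<c (each ∘ suc) =
  p ℚ.⊔ q , max<c , λ { zero → mono (ℚ.p≤p⊔q p q) Pp ; (suc e) → mono (ℚ.p≤q⊔p p q) (Pq e) }
  where
  max<c : p ℚ.⊔ q ℚ.< c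
  max<c with ℚ.⊔-sel p q
  ... | inj₁ eq = subst (ℚ._< c) (sym eq) p<c
  ... | inj₂ eq = subst (ℚ._< c) (sym eq) q<c

-- Validity and height of the schedule

module Solution {n : ℕ} (G : CBGT n) (M : LaminarMatroid (CBGT.𝓘 G)) where
  open CBGT G
  open LaminarMatroid M

  numerator denominator : Fin n → List Bool
  numerator e   = binary ℤ.∣ ↥ g e ∣
  denominator e = binary (↧ₙ (g e))

  frequent : ℕ → Fin n → Bool
  frequent j e = exceeds j (numerator e) (denominator e)

  -- The bits of all denominators, a list that is long enough for its length
  -- to serve as the top level.

  allBits : List Bool
  allBits = foldl (λ acc e → denominator e ʳ++ acc) [] (allFin n)

  top : ℕ
  top = length allBits

  order : List (Fin n)
  -- The reversal matches the program, which builds its list of items by pushing.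
  order = gatherAll (map lookup 𝓛) (reverse (allFin n))

  open Selection frequent (λ j {e} → exceeds-mono j (numerator e) (denominator e)) public

  π : Schedule n
  π t = cutInto ⊥ (halveAt 0 order (counter top t))

  frequent⇒≥ : ∀ j e → frequent j e ≡ true → 1ℚ ℚ.≤ ι (2 ^ j) ℚ.* g e
  frequent⇒≥ j e fr with exceeds j (numerator e) (denominator e)
                       | Exceeds-exceeds j (numerator e) (denominator e)
  ... | true | lt rewrite value-binary ℤ.∣ ↥ g e ∣ | value-binary (↧ₙ (g e)) =
    1≤ι* (2 ^ j) (g-nonneg e) lt

  infrequent⇒≤ : ∀ j e → frequent j e ≡ false → ι (2 ^ j) ℚ.* g e ℚ.≤ 1ℚ
  infrequent⇒≤ j e fr with exceeds j (numerator e) (denominator e)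
                         | Exceeds-exceeds j (numerator e) (denominator e)
  ... | false | le rewrite value-binary ℤ.∣ ↥ g e ∣ | value-binary (↧ₙ (g e)) =
    ι*≤1 (2 ^ j) (g-nonneg e) le

  length-allBits : ∀ es acc → length (foldl (λ acc e → denominator e ʳ++ acc) acc es) ≡
                              sum (map (length ∘ denominator) es) + length acc
  length-allBits []       acc = refl
  length-allBits (e ∷ es) acc = trans (length-allBits es (denominator e ʳ++ acc))
    (trans (cong (λ m → s + m) (length-ʳ++ (denominator e)))
           (rearrange s (length (denominator e)) (length acc)))
    where
    s = sum (map (length ∘ denominator) es)
    rearrange : ∀ x y z → x + (y + z) ≡ y + x + z
    rearrange = solve-∀

  top≡ : top ≡ sum (map (length ∘ denominator) (allFin n))
  top≡ = trans (length-allBits (allFin n) []) (+-identityʳ _)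

  ∈⇒≤sum : ∀ {A : Set} (f : A → ℕ) {x xs} → x ∈ˡ xs → f x ≤ sum (map f xs)
  ∈⇒≤sum f (here refl)           = m≤m+n _ _
  ∈⇒≤sum f (there {y} x∈)        = ≤-trans (∈⇒≤sum f x∈) (m≤n+m _ (f y))

  infrequent⇒0 : ∀ e → frequent top e ≡ false → g e ≡ 0ℚ
  infrequent⇒0 e ¬fr = ℚ.↥p≡0⇒p≡0 (g e) (ℤ.∣i∣≡0⇒i≡0 (trans (sym (value-binary _))
    (exceeds-all top (numerator e) (denominator e)
      (≤-trans (∈⇒≤sum (length ∘ denominator) (∈-allFin e)) (≤-reflexive (sym top≡))) ¬fr)))

  order-↭ : order ↭ allFin n
  order-↭ = ↭-trans (gatherAll-↭ (map lookup 𝓛) (reverse (allFin n))) (↭-reverse (allFin n))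

  laminar-lookup : ∀ {L L′} → L ∈ˡ 𝓛 → L′ ∈ˡ 𝓛 → Laminar (lookup L) (lookup L′)
  laminar-lookup {L} {L′} L∈ L′∈ with 𝓛-laminar L∈ L′∈
  ... | inj₁ L⊆L′        = inj₁ λ h → []=⇒lookup (L⊆L′ (lookup⇒[]= _ _ h))
  ... | inj₂ (inj₁ L′⊆L) = inj₂ (inj₁ λ h → []=⇒lookup (L′⊆L (lookup⇒[]= _ _ h)))
  ... | inj₂ (inj₂ disj) = inj₂ (inj₂ disjoint)
    where
    disjoint : ∀ {e} → lookup L e ≡ true → lookup L′ e ≡ false
    disjoint {e} h with lookup L′ e in h′
    ... | false = refl
    ... | true  = ⊥-elim (∉⊥ (subst (e ∈_) disj (x∈p∩q⁺ (lookup⇒[]= _ _ h , lookup⇒[]= _ _ h′))))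

  order-Contiguous : ∀ {L} → L ∈ˡ 𝓛 → Contiguous (lookup L) order
  order-Contiguous {L} L∈ = gatherAll-Contiguous (map lookup 𝓛) lam (∈-map⁺ lookup L∈)
    where
    lam : ∀ {p} → p ∈ˡ map lookup 𝓛 → Laminar p (lookup L)
    lam p∈ with L′ , L′∈ , refl ← ∈-map⁻ lookup p∈ = laminar-lookup L′∈ L∈

  λ′ : Subset n → ℚ
  λ′ = proj₁ g-convex

  λ′-nonneg : ∀ {I} → I ∈ˡ members → 0ℚ ℚ.≤ λ′ I
  λ′-nonneg {I} I∈ = proj₁ (proj₂ g-convex) I (proj₂ (∈-filter⁻ 𝓘? {xs = subsets n} I∈))

  ∑λ′≡1 : ∑ members λ′ ≡ 1ℚ
  ∑λ′≡1 = proj₁ (proj₂ (proj₂ g-convex))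

  g≡ : ∀ e → g e ≡ ∑ (filter (e ∈?_) members) λ′
  g≡ = proj₂ (proj₂ (proj₂ g-convex))

  g≤1 : ∀ e → g e ℚ.≤ 1ℚ
  g≤1 e = ℚ.≤-trans (ℚ.≤-reflexive (g≡ e))
    (ℚ.≤-trans (∑-filter-≤ e members λ′ λ′-nonneg) (ℚ.≤-reflexive ∑λ′≡1))

  -- The constraint at `L`, averaged over the members with the coefficients `λ′`.
  g-rank : ∀ {L} → L ∈ˡ 𝓛 → ∑ (allFin n) (λ e → [ lookup L e ] g e) ℚ.≤ ι (b L)
  g-rank {L} L∈ = begin
    ∑ (allFin n) (λ e → [ lookup L e ] g e)
      ≡⟨ ∑-cong (allFin n) (λ e → cong ([ lookup L e ]_) (trans (g≡ e) (∑-filter-∈ e members λ′))) ⟩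
    ∑ (allFin n) (λ e → [ lookup L e ] ∑ members (λ I → [ lookup I e ] λ′ I))
      ≤⟨ ∑-weighted-rank L (b L) members λ′ λ′-nonneg
           (λ {I} I∈ → Equivalence.to (𝓘⇔ I) (proj₂ (∈-filter⁻ 𝓘? {xs = subsets n} I∈)) L∈) ⟩
    ∑ members λ′ ℚ.* ι (b L)
      ≡⟨ cong (ℚ._* ι (b L)) ∑λ′≡1 ⟩
    1ℚ ℚ.* ι (b L)
      ≡⟨ ℚ.*-identityˡ _ ⟩
    ι (b L) ∎
    where open ℚ.≤-Reasoning

  double : ∀ j q → ι 2 ℚ.* (ι (2 ^ j) ℚ.* q) ≡ ι (2 ^ suc j) ℚ.* q
  double j q = trans (sym (ℚ.*-assoc (ι 2) (ι (2 ^ j)) q)) (cong (ℚ._* q) (sym (ι-* 2 (2 ^ j))))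

  -- If `k` is the least level of `e`, then `2 ^ k * g e` is at least 1, and multiplying by
  -- `2 ^ (j ∸ k)` gives the claim. The recursion descends to that level.
  weight≤ : ∀ j e → frequent j e ≡ true → ι (weight j e) ℚ.≤ ι (2 ^ j) ℚ.* g e
  weight≤ zero    e fr = frequent⇒≥ 0 e fr
  weight≤ (suc j) e fr with frequent j e in frʲ
  ... | false = frequent⇒≥ (suc j) e fr
  ... | true  = begin
    ι (2 * weight j e)            ≡⟨ ι-* 2 (weight j e) ⟩
    ι 2 ℚ.* ι (weight j e)        ≤⟨ ℚ.*-monoˡ-≤-nonNeg (ι 2) (weight≤ j e frʲ) ⟩
    ι 2 ℚ.* (ι (2 ^ j) ℚ.* g e)   ≡⟨ double j (g e) ⟩
    ι (2 ^ suc j) ℚ.* g e         ∎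
    where open ℚ.≤-Reasoning

  scaled≥0 : ∀ j e → 0ℚ ℚ.≤ ι (2 ^ j) ℚ.* g e
  scaled≥0 j e = ℚ.≤-trans (ℚ.≤-reflexive (sym (ℚ.*-zeroʳ (ι (2 ^ j)))))
    (ℚ.*-monoˡ-≤-nonNeg (ι (2 ^ j)) (g-nonneg e))

  load≤∑ : ∀ j (p : Fin n → Bool) es → ι (load j p (map (λ e → e , frequent j e) es)) ℚ.≤
           ∑ es (λ e → [ p e ] (ι (2 ^ j) ℚ.* g e))
  load≤∑ j p []       = ℚ.≤-refl
  load≤∑ j p (e ∷ es) = ℚ.≤-trans (ℚ.≤-reflexive (ι-+ (if frequent j e ∧ p e then weight j e else 0) _)) (ℚ.+-mono-≤ single (load≤∑ j p es))
    where
    single : ι (if frequent j e ∧ p e then weight j e else 0) ℚ.≤ [ p e ] (ι (2 ^ j) ℚ.* g e)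
    single with frequent j e in fr | p e
    ... | true  | true  = weight≤ j e fr
    ... | true  | false = ℚ.≤-refl
    ... | false | true  = scaled≥0 j e
    ... | false | false = ℚ.≤-refl

  -- The base case for `halveAt-load`: each weight is at most `2 ^ j * g e`, and the rates in `L`
  -- sum to at most `b L`.
  load-frequent : ∀ {L} → L ∈ˡ 𝓛 → ∀ j → load j (lookup L) (map (λ e → e , frequent j e) order) ≤ 2 ^ j * b L
  load-frequent {L} L∈ j = ι-cancel (begin
    ι (load j (lookup L) (map (λ e → e , frequent j e) order)) ≤⟨ load≤∑ j (lookup L) order ⟩
    ∑ order (λ e → [ lookup L e ] (ι (2 ^ j) ℚ.* g e))         ≡⟨ ∑-↭ _ order-↭ ⟩
    ∑ (allFin n) (λ e → [ lookup L e ] (ι (2 ^ j) ℚ.* g e))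
      ≡⟨ ∑-cong (allFin n) (λ e → []-* (lookup L e) (ι (2 ^ j)) (g e)) ⟩
    ∑ (allFin n) (λ e → ι (2 ^ j) ℚ.* [ lookup L e ] g e)      ≡⟨ ∑-distribˡ (allFin n) (ι (2 ^ j)) _ ⟩
    ι (2 ^ j) ℚ.* ∑ (allFin n) (λ e → [ lookup L e ] g e)      ≤⟨ ℚ.*-monoˡ-≤-nonNeg (ι (2 ^ j)) (g-rank L∈) ⟩
    ι (2 ^ j) ℚ.* ι (b L)                                      ≡⟨ ι-* (2 ^ j) (b L) ⟨
    ι (2 ^ j * b L)                                            ∎)
    where
    open ℚ.≤-Reasoning
    []-* : ∀ c p q → [ c ] (p ℚ.* q) ≡ p ℚ.* [ c ] q
    []-* true  p q = refl
    []-* false p q = sym (ℚ.*-zeroʳ p)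

  -- At level 0 every weight is 1, so the load counts the insertions into `L`.
  ∣cutInto∩∣ : ∀ (S L : Subset n) xs → ∣ cutInto S xs ∩ L ∣ ≤ load 0 (lookup L) xs + ∣ S ∩ L ∣
  ∣cutInto∩∣ S L []                  = ≤-refl
  ∣cutInto∩∣ S L ((e , false) ∷ xs) = ∣cutInto∩∣ S L xs
  ∣cutInto∩∣ S L ((e , true) ∷ xs)  = begin
    ∣ cutInto (S [ e ]≔ inside) xs ∩ L ∣                              ≤⟨ ∣cutInto∩∣ _ L xs ⟩
    load 0 (lookup L) xs + ∣ (S [ e ]≔ inside) ∩ L ∣                 ≤⟨ +-monoʳ-≤ _ (∣insert∩∣ S L e) ⟩
    load 0 (lookup L) xs + (bit (lookup L e) + ∣ S ∩ L ∣)            ≡⟨ rearrange (load 0 (lookup L) xs) (bit (lookup L e)) ∣ S ∩ L ∣ ⟩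
    bit (lookup L e) + load 0 (lookup L) xs + ∣ S ∩ L ∣              ∎
    where
    open ≤-Reasoning
    rearrange : ∀ x y z → x + (y + z) ≡ y + x + z
    rearrange = solve-∀

  π-valid : Valid G π
  π-valid t = Equivalence.from (𝓘⇔ (π t)) λ {L} L∈ → begin
    ∣ π t ∩ L ∣                          ≤⟨ ∣cutInto∩∣ ⊥ L xs ⟩
    load 0 (lookup L) xs + ∣ ⊥ ∩ L ∣     ≡⟨ cong (λ m → load 0 (lookup L) xs + m) (∣⊥∩∣ L) ⟩
    load 0 (lookup L) xs + 0             ≡⟨ +-identityʳ _ ⟩
    load 0 (lookup L) xs
      ≤⟨ halveAt-load (lookup L) order (b L) (order-Contiguous L∈) (load-frequent L∈) 0 (counter top t) ⟩
    1 * b L                              ≡⟨ *-identityˡ (b L) ⟩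
    b L                                  ∎
    where
    open ≤-Reasoning
    xs = halveAt 0 order (counter top t)

  -- Descend as long as the next lower level is still frequent. Either the descent stops above an
  -- infrequent level, whose bound 1 doubles to 2, or it reaches level 0, where `g e ≤ 1`.
  least-frequent : ∀ e k → frequent k e ≡ true →
                   ∃[ κ ] κ ≤ k × frequent κ e ≡ true × ι (2 ^ κ) ℚ.* g e ℚ.≤ ι 2
  least-frequent e zero    fr = 0 , z≤n , fr ,
    ℚ.≤-trans (ℚ.≤-reflexive (ℚ.*-identityˡ _)) (ℚ.≤-trans (g≤1 e) (ι-mono {1} {2} (s≤s z≤n)))
  least-frequent e (suc k) fr with frequent k e in frᵏ
  ... | true  with κ , κ≤k , rest ← least-frequent e k frᵏ = κ , m≤n⇒m≤1+n κ≤k , rest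
  ... | false = suc k , ≤-refl , fr , (begin
    ι (2 ^ suc k) ℚ.* g e       ≡⟨ double k (g e) ⟨
    ι 2 ℚ.* (ι (2 ^ k) ℚ.* g e) ≤⟨ ℚ.*-monoˡ-≤-nonNeg (ι 2) (infrequent⇒≤ k e frᵏ) ⟩
    ι 2 ℚ.* 1ℚ                  ≡⟨ ℚ.*-identityʳ (ι 2) ⟩
    ι 2                         ∎)
    where open ℚ.≤-Reasoning

  positive-rate : ∀ e κ → frequent κ e ≡ true → 0ℚ ℚ.< g e
  positive-rate e κ fr = ℚ.≰⇒> λ g≤0 → 1≰0 (begin
    1ℚ                     ≤⟨ frequent⇒≥ κ e fr ⟩
    ι (2 ^ κ) ℚ.* g e      ≤⟨ ℚ.*-monoˡ-≤-nonNeg (ι (2 ^ κ)) g≤0 ⟩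
    ι (2 ^ κ) ℚ.* 0ℚ       ≡⟨ ℚ.*-zeroʳ (ι (2 ^ κ)) ⟩
    0ℚ                     ∎)
    where
    open ℚ.≤-Reasoning
    1≰0 : ¬ (1ℚ ℚ.≤ 0ℚ)
    1≰0 (*≤* (ℤ.+≤+ ()))

  π-cuts : ∀ e κ → κ ≤ top → frequent κ e ≡ true →
           ∀ q → ∃[ r ] r < 2 ^ κ × lookup (π (q * 2 ^ κ + r)) e ≡ true
  π-cuts e κ κ≤top fr q
    -- The window starts from level 0, and the other `top ∸ κ` bits fill the counter up to length
    -- `top`.
    with r , r< , e∈ ← window {es = order} κ fr (∈-resp-↭ (↭-sym order-↭) (∈-allFin e)) κ 0 (top ∸ κ) q refl =
    r , r< , cutInto-∈ ⊥ _ (subst (λ K → (e , true) ∈ˡ halveAt 0 order (counter K (q * 2 ^ κ + r))) (m+[n∸m]≡n κ≤top) e∈)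

  ∃-height : ∀ e → ∃[ c ] c ℚ.< ι 4 × (∀ t → heightOn G π t e ℚ.≤ c)
  ∃-height e with frequent top e in fr
  -- Being infrequent even at the top level forces rate zero.
  ... | false = 0ℚ , *<* (ℤ.+<+ (s≤s z≤n)) , λ t → ℚ.≤-reflexive (begin
    heightOn G π t e                   ≡⟨ height-age G π t e ⟩
    ι (suc (age π e t)) ℚ.* g e        ≡⟨ cong (ι (suc (age π e t)) ℚ.*_) (infrequent⇒0 e fr) ⟩
    ι (suc (age π e t)) ℚ.* 0ℚ         ≡⟨ ℚ.*-zeroʳ (ι (suc (age π e t))) ⟩
    0ℚ                                 ∎)
    where open ≡-Reasoning
  ... | true with κ , κ≤top , frᵏ , small ← least-frequent e top fr =
    -- With `w = 2 ^ κ`, `age-windows` bounds the height by `2 * w * g e - g e`, and `w * g e ≤ 2`.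
    -- Subtracting the positive rate makes the bound strictly smaller than 4.
    ι 4 ℚ.- g e , below , bound
    where
    open ℚ.≤-Reasoning
    below : ι 4 ℚ.- g e ℚ.< ι 4
    below = begin-strict
      ι 4 ℚ.- g e <⟨ ℚ.+-monoʳ-< (ι 4) (ℚ.neg-antimono-< (positive-rate e κ frᵏ)) ⟩
      ι 4 ℚ.+ 0ℚ  ≡⟨ ℚ.+-identityʳ (ι 4) ⟩
      ι 4         ∎
    cancel : ∀ x y → x ≡ (x ℚ.+ y) ℚ.- y
    cancel = solve 2 (λ x y → x := (x :+ y) :- y) refl
      where open +-*-Solver
    bound : ∀ t → heightOn G π t e ℚ.≤ ι 4 ℚ.- g e
    bound t = begin
      heightOn G π t e                           ≡⟨ height-age G π t e ⟩
      ι a ℚ.* g e                                ≡⟨ cancel _ (g e) ⟩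
      (ι a ℚ.* g e ℚ.+ g e) ℚ.- g e              ≡⟨ cong (λ h → (ι a ℚ.* g e ℚ.+ h) ℚ.- g e) (ℚ.*-identityˡ (g e)) ⟨
      (ι a ℚ.* g e ℚ.+ 1ℚ ℚ.* g e) ℚ.- g e       ≡⟨ cong (ℚ._- g e) (ℚ.*-distribʳ-+ (g e) (ι a) 1ℚ) ⟨
      (ι a ℚ.+ ι 1) ℚ.* g e ℚ.- g e              ≡⟨ cong (λ h → h ℚ.* g e ℚ.- g e) (trans (sym (ι-+ a 1)) (cong ι (+-comm a 1))) ⟩
      ι (suc a) ℚ.* g e ℚ.- g e
        ≤⟨ ℚ.+-monoˡ-≤ (ℚ.- g e) (ℚ.*-monoʳ-≤-nonNeg (g e) {{ℚ.nonNegative (g-nonneg e)}}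
             (ι-mono (age-windows π e (2 ^ κ) {{m^n≢0 2 κ}} (π-cuts e κ κ≤top frᵏ) t))) ⟩
      ι (2 ^ suc κ) ℚ.* g e ℚ.- g e              ≡⟨ cong (ℚ._- g e) (double κ (g e)) ⟨
      ι 2 ℚ.* (ι (2 ^ κ) ℚ.* g e) ℚ.- g e        ≤⟨ ℚ.+-monoˡ-≤ (ℚ.- g e) (ℚ.*-monoˡ-≤-nonNeg (ι 2) small) ⟩
      ι 4 ℚ.- g e                                ∎
      where a = suc (age π e t)

  π-height : HeightBelow G π (ι 4)
  π-height = ∃-bound (ι 4) (λ e c → ∀ t → heightOn G π t e ℚ.≤ c)
    (λ p≤q h t → ℚ.≤-trans (h t) p≤q) (*<* (ℤ.+<+ (s≤s z≤n))) ∃-height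

-- Implementation

encodeBits : List Bool → Tree
encodeBits = encodeList encodeBool

trueProg : Prog
trueProg = ⟨ nil , nil ⟩

falses : Prog
falses = ⟨ skip , nil ⟩ ⨾ each ⟨ nil , tl ⟩

-- The result is stated reversed because the state stores the counter reversed.
falses⇓ : ∀ {A : Set} {enc : A → Tree} {N} xs → length xs ≤ N →
          falses ∶ encodeList enc xs ⇓ encodeBits (reverse (replicate (length xs) false)) ⟪ N ⟫
falses⇓ {enc = enc} {N} xs len = eval⇓ ⟨ skip , nil ⟩ ⨾⇓ each⇓ _ _ _ len (go xs [])
  where
  go : ∀ xs ys → Iterate ⟨ nil , tl ⟩ N enc (encodeBits ys) xs
                   (encodeBits (replicate (length xs) false ʳ++ ys))
  go []       ys = []
  go (x ∷ xs) ys = eval⇓ ⟨ nil , tl ⟩ ∷ go xs (false ∷ ys)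

reverse-replicate : ∀ {A : Set} m (x : A) → reverse (replicate m x) ≡ replicate m x
reverse-replicate m x = trans (go m 0) (cong (λ k → replicate k x) (+-identityʳ m))
  where
  go : ∀ m k → replicate m x ʳ++ replicate k x ≡ replicate (m + k) x
  go zero    k = refl
  go (suc m) k = trans (go m (suc k)) (cong (λ l → replicate l x) (+-suc m k))

compareStep : Prog
compareStep = ⟨ tl ⨾ hd ⨾ tl , cond hd (cond (tl ⨾ hd ⨾ hd) (tl ⨾ tl) trueProg) (cond (tl ⨾ hd ⨾ hd) nil (tl ⨾ tl)) ⟩

-- The first loop runs along the left number. It leaves the unread bits of the right number paired
-- with the flag, which is the input format of the second loop, the counterpart of `compareZero`.
compareProg : Prog
compareProg = ⟨ hd , ⟨ tl , nil ⟩ ⟩ ⨾ each compareStep ⨾ each (cond hd nil tl)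

compareStep⇓ : ∀ {N} x ys r → compareStep ∶ encodeBool x ∙ encodeBits ys ∙ encodeBool r ⇓
                 encodeBits (drop 1 ys) ∙ encodeBool (compareBit x (lsb ys) r) ⟪ N ⟫
compareStep⇓ true  []           r = eval⇓ compareStep
compareStep⇓ true  (true ∷ ys)  r = eval⇓ compareStep
compareStep⇓ true  (false ∷ ys) r = eval⇓ compareStep
compareStep⇓ false []           r = eval⇓ compareStep
compareStep⇓ false (true ∷ ys)  r = eval⇓ compareStep
compareStep⇓ false (false ∷ ys) r = eval⇓ compareStep

compareProg⇓ : ∀ {N} xs ys → length xs ≤ N → length ys ≤ N →
               compareProg ∶ encodeBits xs ∙ encodeBits ys ⇓ encodeBool (compare false xs ys) ⟪ N ⟫
compareProg⇓ {N} xs ys xs≤N ys≤N =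
  let ys′ , r , ys′≤ , eq , it = common xs ys false in
  eval⇓ ⟨ hd , ⟨ tl , nil ⟩ ⟩ ⨾⇓ each⇓ _ _ _ xs≤N it ⨾⇓
  each⇓ _ _ _ (≤-trans ys′≤ ys≤N)
    (subst (λ c → Iterate (cond hd nil tl) N encodeBool (encodeBool r) ys′ (encodeBool c)) eq (rest ys′ r))
  where
  common : ∀ xs ys r → ∃[ ys′ ] ∃[ r′ ] length ys′ ≤ length ys × compareZero r′ ys′ ≡ compare r xs ys ×
           Iterate compareStep N encodeBool (encodeBits ys ∙ encodeBool r) xs (encodeBits ys′ ∙ encodeBool r′)
  common []       ys r = ys , r , ≤-refl , refl , []
  common (x ∷ xs) ys r with ys′ , r′ , le , eq , it ← common xs (drop 1 ys) (compareBit x (lsb ys) r) =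
    ys′ , r′ , ≤-trans le (≤-trans (≤-reflexive (length-drop 1 ys)) (m∸n≤m (length ys) 1)) , eq ,
    compareStep⇓ x ys r ∷ it
  rest : ∀ ys r → Iterate (cond hd nil tl) N encodeBool (encodeBool r) ys (encodeBool (compareZero r ys))
  rest []           r = []
  rest (true ∷ ys)  r = eval⇓ (cond hd nil tl) ∷ rest ys false
  rest (false ∷ ys) r = eval⇓ (cond hd nil tl) ∷ rest ys r

-- The element number i is represented by i zeros followed by a one.

index : ℕ → List Bool
index zero    = true ∷ []
index (suc i) = false ∷ index i

length-index : ∀ i → length (index i) ≡ suc i
length-index zero    = refl
length-index (suc i) = cong suc (length-index i)

-- Each digit of the index removes one cell from the state. An index has one digit more than its
-- number, so the dummy `nil` in front is removed too and the wanted entry ends up at the head.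
memberProg : Prog
memberProg = ⟨ hd , ⟨ nil , tl ⟩ ⟩ ⨾ each (tl ⨾ tl) ⨾ hd

memberProg⇓ : ∀ {N m} (e : Fin m) (L : Subset m) → m ≤ N →
              memberProg ∶ encodeBits (index (toℕ e)) ∙ encodeSubset L ⇓ encodeBool (lookup L e) ⟪ N ⟫
memberProg⇓ {N} e L m≤N =
  let s , it = go e L nil in
  eval⇓ ⟨ hd , ⟨ nil , tl ⟩ ⟩ ⨾⇓
  each⇓ _ _ _ (≤-trans (≤-reflexive (length-index (toℕ e))) (≤-trans (toℕ<n e) m≤N)) it ⨾⇓ eval⇓ hd
  where
  go : ∀ {m} (e : Fin m) (L : Subset m) y →
       ∃[ s ] Iterate (tl ⨾ tl) N encodeBool (y ∙ encodeSubset L) (index (toℕ e)) (encodeBool (lookup L e) ∙ s)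
  go zero    (l ∷ L) y = encodeSubset L , eval⇓ (tl ⨾ tl) ∷ []
  go (suc e) (l ∷ L) y with s , it ← go e L (encodeBool l) = s , eval⇓ (tl ⨾ tl) ∷ it

-- The set and the index are read in parallel, and the one that ends the index marks the entry to
-- set. Afterwards `hd` of the exhausted index is false, so the remaining entries are copied.
setStep insertProg : Prog
setStep    = ⟨ tl ⨾ hd ⨾ tl , ⟨ cond (tl ⨾ hd ⨾ hd) trueProg hd , tl ⨾ tl ⟩ ⟩
insertProg = ⟨ tl , ⟨ hd ⨾ hd , nil ⟩ ⟩ ⨾ each setStep ⨾ ⟨ tl , nil ⟩ ⨾ each skip

insertProg⇓ : ∀ {N m} (e : Fin m) (S : Subset m) {r} → m ≤ N →
              insertProg ∶ (encodeBits (index (toℕ e)) ∙ r) ∙ encodeSubset S ⇓ encodeSubset (S [ e ]≔ inside) ⟪ N ⟫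
insertProg⇓ {N} {m} e S m≤N =
  let i , it = go e S [] in
  eval⇓ ⟨ tl , ⟨ hd ⨾ hd , nil ⟩ ⟩ ⨾⇓
  each⇓ _ _ _ (len S) it ⨾⇓
  eval⇓ ⟨ tl , nil ⟩ ⨾⇓
  subst (λ xs → each skip ∶ encodeBits (reverse (toList (S [ e ]≔ inside))) ∙ nil ⇓ encodeBits xs ⟪ N ⟫)
    (reverse-involutive (toList (S [ e ]≔ inside)))
    (reverse⇓ (reverse (toList (S [ e ]≔ inside)))
      (≤-trans (≤-reflexive (length-reverse (toList (S [ e ]≔ inside)))) (len (S [ e ]≔ inside))))
  where
  len : ∀ (S : Subset m) → length (toList S) ≤ N
  len S = ≤-trans (≤-reflexive (length-toList S)) m≤N
  copy : ∀ xs ys → Iterate setStep N encodeBool (nil ∙ encodeBits ys) xs (nil ∙ encodeBits (xs ʳ++ ys))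
  copy []       ys = []
  copy (x ∷ xs) ys = eval⇓ setStep ∷ copy xs (x ∷ ys)
  go : ∀ {m} (e : Fin m) (S : Subset m) ys →
       ∃[ i ] Iterate setStep N encodeBool (encodeBits (index (toℕ e)) ∙ encodeBits ys) (toList S)
                (i ∙ encodeBits (toList (S [ e ]≔ inside) ʳ++ ys))
  go zero    (s ∷ S) ys = nil , eval⇓ setStep ∷ copy (toList S) (true ∷ ys)
  go (suc e) (s ∷ S) ys with i , it ← go e S (s ∷ ys) = i , eval⇓ setStep ∷ it

-- The state keeps the counter most significant bit first, the order in which the levels are halved.
-- It is reversed to propagate the carry, and pushing the new bits restores the order.
incrementStep incrementProg : Prog
incrementStep = ⟨ cond hd (tl ⨾ hd) nil , ⟨ cond hd (cond (tl ⨾ hd) nil trueProg) (tl ⨾ hd) , tl ⨾ tl ⟩ ⟩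
incrementProg = ⟨ skip , nil ⟩ ⨾ each skip ⨾ ⟨ skip , ⟨ trueProg , nil ⟩ ⟩ ⨾ each incrementStep ⨾ tl

incrementProg⇓ : ∀ {N} bs → length bs ≤ N →
                 incrementProg ∶ encodeBits (reverse bs) ⇓ encodeBits (reverse (increment true bs)) ⟪ N ⟫
incrementProg⇓ {N} bs bs≤N =
  let c , it = go true bs [] in
  eval⇓ ⟨ skip , nil ⟩ ⨾⇓
  subst (λ xs → each skip ∶ encodeBits (reverse bs) ∙ nil ⇓ encodeBits xs ⟪ N ⟫) (reverse-involutive bs)
    (reverse⇓ (reverse bs) (≤-trans (≤-reflexive (length-reverse bs)) bs≤N)) ⨾⇓
  eval⇓ ⟨ skip , ⟨ trueProg , nil ⟩ ⟩ ⨾⇓ each⇓ _ _ _ bs≤N it ⨾⇓ eval⇓ tl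
  where
  step⇓ : ∀ b c ys → incrementStep ∶ encodeBool b ∙ encodeBool c ∙ encodeBits ys ⇓
            encodeBool (b ∧ c) ∙ encodeBits ((b xor c) ∷ ys) ⟪ N ⟫
  step⇓ true  true  ys = eval⇓ incrementStep
  step⇓ true  false ys = eval⇓ incrementStep
  step⇓ false c     ys = eval⇓ incrementStep
  go : ∀ c bs ys → ∃[ c′ ] Iterate incrementStep N encodeBool (encodeBool c ∙ encodeBits ys) bs
                     (c′ ∙ encodeBits (increment c bs ʳ++ ys))
  go c []       ys = encodeBool c , []
  go c (b ∷ bs) ys with c′ , it ← go (b ∧ c) bs ((b xor c) ∷ ys) = c′ , step⇓ b c ys ∷ it

-- Items consist of an index, the flags frequent (j - 1), ..., frequent 0,
-- and the flag of a set.

rowStep rowProg itemStep : Prog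
rowStep  = ⟨ tl ⨾ hd , ⟨ tl ⨾ tl ⨾ hd ⨾ tl , ⟨ ⟨ tl ⨾ hd , tl ⨾ tl ⨾ hd ⟩ ⨾ compareProg , tl ⨾ tl ⨾ tl ⟩ ⟩ ⟩
rowProg  = ⟨ tl ⨾ hd , ⟨ hd ⨾ hd , ⟨ hd ⨾ tl , nil ⟩ ⟩ ⟩ ⨾ each rowStep
           ⨾ ⟨ tl ⨾ tl , ⟨ hd , tl ⨾ hd ⟩ ⨾ compareProg ⟩
itemStep = ⟨ tl ⨾ hd , ⟨ ⟨ nil , tl ⨾ tl ⨾ hd ⟩ , ⟨ ⟨ tl ⨾ tl ⨾ hd , rowProg ⟩ , tl ⨾ tl ⨾ tl ⟩ ⟩ ⟩

bitsStep : Prog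
bitsStep = ⟨ hd ⨾ tl , tl ⟩ ⨾ each skip

gatherStepProg unstackProg gatherProg : Prog
gatherStepProg =
  cond (⟨ hd ⨾ hd , tl ⨾ hd ⟩ ⨾ memberProg)
    ⟨ tl ⨾ hd , ⟨ tl ⨾ tl ⨾ hd , ⟨ ⟨ hd , tl ⨾ tl ⨾ tl ⨾ hd ⟩ , tl ⨾ tl ⨾ tl ⨾ tl ⟩ ⟩ ⟩
    (cond (tl ⨾ tl ⨾ tl ⨾ hd)
      ⟨ tl ⨾ hd , ⟨ tl ⨾ tl ⨾ hd , ⟨ tl ⨾ tl ⨾ tl ⨾ hd , ⟨ hd , tl ⨾ tl ⨾ tl ⨾ tl ⟩ ⟩ ⟩ ⟩
      ⟨ tl ⨾ hd , ⟨ ⟨ hd , tl ⨾ tl ⨾ hd ⟩ , tl ⨾ tl ⨾ tl ⟩ ⟩)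
unstackProg =
  ⟨ tl ⨾ hd , ⟨ tl ⨾ tl ⨾ hd , ⟨ tl ⨾ tl ⨾ tl , nil ⟩ ⨾ each skip ⟩ ⨾ each skip ⟩ ⨾ each skip
gatherProg =
  ⟨ tl , ⟨ hd ⨾ hd , ⟨ nil , ⟨ nil , nil ⟩ ⟩ ⟩ ⟩ ⨾ each gatherStepProg ⨾ unstackProg

-- The intermediate trees are `allBits` paired with the input, then `allBits` with the items and the
-- constraints, and finally the ordered items with a zero counter.
preprocessProg : Prog
preprocessProg =
  ⟨ ⟨ hd , nil ⟩ ⨾ each bitsStep , skip ⟩
  ⨾ ⟨ hd , ⟨ ⟨ tl ⨾ hd , ⟨ hd , ⟨ ⟨ trueProg , nil ⟩ , nil ⟩ ⟩ ⟩ ⨾ each itemStep ⨾ tl ⨾ tl , tl ⨾ tl ⟩ ⟩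
  ⨾ ⟨ ⟨ tl ⨾ tl , tl ⨾ hd ⟩ ⨾ each gatherProg , hd ⨾ falses ⟩

-- Every item carries its own flags, highest level first. Popping one flag per level replaces any
-- arithmetic with level numbers.
halveStep levelStep : Prog
halveStep =
  cond (hd ⨾ tl ⨾ hd ⨾ hd)
    ⟨ tl ⨾ hd , ⟨ ⟨ hd ⨾ hd , ⟨ hd ⨾ tl ⨾ hd ⨾ tl , trueProg ⟩ ⟩ , tl ⨾ tl ⟩ ⟩
    (cond (hd ⨾ tl ⨾ tl)
      ⟨ cond (tl ⨾ hd) nil trueProg , ⟨ ⟨ hd ⨾ hd , ⟨ hd ⨾ tl ⨾ hd ⨾ tl , tl ⨾ hd ⟩ ⟩ , tl ⨾ tl ⟩ ⟩
      ⟨ tl ⨾ hd , ⟨ ⟨ hd ⨾ hd , ⟨ hd ⨾ tl ⨾ hd ⨾ tl , nil ⟩ ⟩ , tl ⨾ tl ⟩ ⟩)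
levelStep = ⟨ tl , ⟨ hd , nil ⟩ ⟩ ⨾ each halveStep ⨾ ⟨ tl , nil ⟩ ⨾ each skip

insertStep cutProg : Prog
insertStep = cond (hd ⨾ tl ⨾ tl) insertProg tl
cutProg    = ⟨ skip , falses ⟩ ⨾ each insertStep

stepProg : Prog
stepProg = ⟨ ⟨ tl , hd ⟩ ⨾ each levelStep ⨾ cutProg , ⟨ hd , tl ⨾ incrementProg ⟩ ⟩

algorithm : Algorithm
algorithm = record { preprocess = preprocessProg ; step = stepProg }

-- Correctness and cost of the programs

encodeList-map : ∀ {A B : Set} (enc : B → Tree) (f : A → B) xs →
                 encodeList enc (map f xs) ≡ encodeList (enc ∘ f) xs
encodeList-map enc f []       = refl
encodeList-map enc f (x ∷ xs) = cong (enc (f x) ∙_) (encodeList-map enc f xs)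

module Implementation {n : ℕ} (G : CBGT n) (M : LaminarMatroid (CBGT.𝓘 G)) (N : ℕ)
  (n≤N : n ≤ N) (top≤N : Solution.top G M ≤ N) (𝓛≤N : length (LaminarMatroid.𝓛 M) ≤ N)
  (numerator≤N : ∀ e → length (Solution.numerator G M e) ≤ N)
  (denominator≤N : ∀ e → length (Solution.denominator G M e) ≤ N) where

  open CBGT G
  open LaminarMatroid M
  open Solution G M

  row : ℕ → Fin n → Tree
  row zero    e = nil
  row (suc j) e = encodeBool (frequent j e) ∙ row j e

  encodeItem : ℕ → Fin n × Bool → Tree
  encodeItem j (e , c) = encodeBits (index (toℕ e)) ∙ row j e ∙ encodeBool c

  encodeElement : Fin n → Tree
  encodeElement e = encodeItem top (e , frequent top e)

  encodeRate : Fin n → Tree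
  encodeRate e = encodeℚ≥0 (g e)

  encodeRate≡ : ∀ e → encodeRate e ≡ encodeBits (numerator e) ∙ encodeBits (denominator e)
  encodeRate≡ e = cong₂ _∙_ (encodeℕ-binary _) (encodeℕ-binary _)

  drop≤N : ∀ e i → length (drop i (denominator e)) ≤ N
  drop≤N e i = ≤-trans (≤-reflexive (length-drop i (denominator e)))
                       (≤-trans (m∸n≤m (length (denominator e)) i) (denominator≤N e))

  frequent⇓ : ∀ i e → compareProg ∶ encodeBits (numerator e) ∙ encodeBits (drop i (denominator e)) ⇓
                        encodeBool (frequent i e) ⟪ N ⟫
  frequent⇓ i e = compareProg⇓ (numerator e) (drop i (denominator e)) (numerator≤N e) (drop≤N e i)

  rowState : ℕ → Fin n → Tree
  rowState i e = encodeBits (numerator e) ∙ encodeBits (drop i (denominator e)) ∙ row i e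

  encodeBits-drop : ∀ i bs → tail (encodeBits (drop i bs)) ≡ encodeBits (drop (suc i) bs)
  encodeBits-drop zero    []       = refl
  encodeBits-drop zero    (b ∷ bs) = refl
  encodeBits-drop (suc i) []       = refl
  encodeBits-drop (suc i) (b ∷ bs) = encodeBits-drop i bs

  rowStep⇓ : ∀ i e {x} → rowStep ∶ x ∙ rowState i e ⇓ rowState (suc i) e ⟪ N ⟫
  rowStep⇓ i e = ⟨ eval⇓ (tl ⨾ hd) , ⟨
    subst (λ y → tl ⨾ tl ⨾ hd ⨾ tl ∶ _ ∙ rowState i e ⇓ y ⟪ N ⟫) (encodeBits-drop i (denominator e))
      (eval⇓ (tl ⨾ tl ⨾ hd ⨾ tl)) ,
    ⟨ eval⇓ ⟨ tl ⨾ hd , tl ⨾ tl ⨾ hd ⟩ ⨾⇓ frequent⇓ i e , eval⇓ (tl ⨾ tl ⨾ tl) ⟩⇓ ⟩⇓ ⟩⇓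

  -- Here `allBits` is a clock with `top` ticks. Each tick pushes the flag of the current level and
  -- drops one bit of the denominator, so the highest level ends up at the head of the row.
  rowProg⇓ : ∀ e {s} → rowProg ∶ encodeRate e ∙ encodeBits allBits ∙ s ⇓ row top e ∙ encodeBool (frequent top e) ⟪ N ⟫
  rowProg⇓ e rewrite encodeRate≡ e =
    eval⇓ ⟨ tl ⨾ hd , ⟨ hd ⨾ hd , ⟨ hd ⨾ tl , nil ⟩ ⟩ ⟩ ⨾⇓
    each⇓ _ _ _ top≤N (go allBits 0 refl) ⨾⇓
    ⟨ eval⇓ (tl ⨾ tl) , eval⇓ ⟨ hd , tl ⨾ hd ⟩ ⨾⇓ frequent⇓ top e ⟩⇓
    where
    go : ∀ bs i {j} → i + length bs ≡ j → Iterate rowStep N encodeBool (rowState i e) bs (rowState j e)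
    go []       i refl = subst (λ j → Iterate rowStep N encodeBool (rowState i e) [] (rowState j e)) (sym (+-identityʳ i)) []
    go (b ∷ bs) i eq   = rowStep⇓ i e ∷ go bs (suc i) (trans (sym (+-suc i (length bs))) eq)

  items⇓ : each itemStep ∶ encodeList encodeRate (allFin n) ∙ encodeBits allBits ∙ encodeBits (index 0) ∙ nil ⇓
             encodeBits allBits ∙ encodeBits (index n) ∙ encodeList encodeElement (reverse (allFin n)) ⟪ N ⟫
  items⇓ = each⇓ _ _ _ (≤-trans (≤-reflexive (length-tabulate id)) n≤N) (go n 0 id (λ _ → refl) [])
    where
    state : ℕ → List (Fin n) → Tree
    state k ys = encodeBits allBits ∙ encodeBits (index k) ∙ encodeList encodeElement ys
    -- Generalised from `allFin n` to a tabulated range of elements numbered from `k`, so that the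
    -- running index is part of the induction.
    go : ∀ m k (f : Fin m → Fin n) → (∀ i → toℕ (f i) ≡ k + toℕ i) → ∀ ys →
         Iterate itemStep N encodeRate (state k ys) (tabulate f) (state (k + m) (tabulate f ʳ++ ys))
    go zero    k f eq ys = subst (λ j → Iterate itemStep N encodeRate (state k ys) [] (state j ys)) (sym (+-identityʳ k)) []
    go (suc m) k f eq ys =
      subst (λ i → itemStep ∶ encodeRate e ∙ state k ys ⇓
                     encodeBits allBits ∙ encodeBits (index (suc k)) ∙
                     (encodeBits (index i) ∙ row top e ∙ encodeBool (frequent top e)) ∙ encodeList encodeElement ys ⟪ N ⟫)
        (sym (trans (eq zero) (+-identityʳ k)))
        ⟨ eval⇓ (tl ⨾ hd) , ⟨ ⟨ eval⇓ nil , eval⇓ (tl ⨾ tl ⨾ hd) ⟩⇓ ,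
          ⟨ ⟨ eval⇓ (tl ⨾ tl ⨾ hd) , rowProg⇓ e ⟩⇓ , eval⇓ (tl ⨾ tl ⨾ tl) ⟩⇓ ⟩⇓ ⟩⇓
      ∷ subst (λ j → Iterate itemStep N encodeRate (state (suc k) (e ∷ ys)) (tabulate (f ∘ suc))
                       (state j (tabulate f ʳ++ ys))) (sym (+-suc k m))
          (go m (suc k) (f ∘ suc) (λ i → trans (eq (suc i)) (+-suc k (toℕ i))) (e ∷ ys))
      where e = f zero

  allBits⇓ : ⟨ hd , nil ⟩ ⨾ each bitsStep ∶ encodeInput G M ⇓ encodeBits allBits ⟪ N ⟫
  allBits⇓ = eval⇓ ⟨ hd , nil ⟩ ⨾⇓
    each⇓ _ _ _ (≤-trans (≤-reflexive (length-tabulate id)) n≤N) (go (allFin n) [])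
    where
    step⇓ : ∀ e bs → bitsStep ∶ encodeRate e ∙ encodeBits bs ⇓ encodeBits (denominator e ʳ++ bs) ⟪ N ⟫
    step⇓ e bs rewrite encodeRate≡ e = eval⇓ ⟨ hd ⨾ tl , tl ⟩ ⨾⇓ reverse⇓ (denominator e) (denominator≤N e)
    go : ∀ es bs → Iterate bitsStep N encodeRate (encodeBits bs) es
                     (encodeBits (foldl (λ acc e → denominator e ʳ++ acc) bs es))
    go []       bs = []
    go (e ∷ es) bs = step⇓ e bs ∷ go es (denominator e ʳ++ bs)

  encodeStacks : Subset n → Stacks → Tree
  encodeStacks L (us , vs , ws) =
    encodeSubset L ∙ encodeList encodeElement us ∙ encodeList encodeElement vs ∙ encodeList encodeElement ws

  gatherStep⇓ : ∀ L e s → gatherStepProg ∶ encodeElement e ∙ encodeStacks L s ⇓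
                            encodeStacks L (gatherStep (lookup L) e s) ⟪ N ⟫
  gatherStep⇓ L e (us , vs , ws) with member⇓ ← memberProg⇓ e L n≤N with lookup L e | vs
  ... | true  | _ = then⇓ (eval⇓ ⟨ hd ⨾ hd , tl ⨾ hd ⟩ ⨾⇓ member⇓)
    (eval⇓ ⟨ tl ⨾ hd , ⟨ tl ⨾ tl ⨾ hd , ⟨ ⟨ hd , tl ⨾ tl ⨾ tl ⨾ hd ⟩ , tl ⨾ tl ⨾ tl ⨾ tl ⟩ ⟩ ⟩)
  ... | false | []    = else⇓ (eval⇓ ⟨ hd ⨾ hd , tl ⨾ hd ⟩ ⨾⇓ member⇓) (eval⇓ _)
  ... | false | _ ∷ _ = else⇓ (eval⇓ ⟨ hd ⨾ hd , tl ⨾ hd ⟩ ⨾⇓ member⇓) (eval⇓ _)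

  -- Each element lands on one stack, so this total bounds the three reversals in `unstackProg`.
  height-stacks : Stacks {Fin n} → ℕ
  height-stacks (us , vs , ws) = length us + (length vs + length ws)

  height-gatherStep : ∀ (p : Fin n → Bool) e s → height-stacks (gatherStep p e s) ≡ suc (height-stacks s)
  height-gatherStep p e (us , vs , ws) with p e | vs
  ... | true  | vs    = +-suc (length us) (length vs + length ws)
  ... | false | []    = refl
  ... | false | _ ∷ _ = trans (cong (λ k → length us + suc k) (+-suc _ _)) (+-suc (length us) _)

  height-gatherLoop : ∀ (p : Fin n → Bool) es s → height-stacks (gatherLoop p es s) ≡ length es + height-stacks s
  height-gatherLoop p []       s = refl
  height-gatherLoop p (e ∷ es) s = trans (height-gatherLoop p es (gatherStep p e s))
    (trans (cong (λ k → length es + k) (height-gatherStep p e s)) (+-suc (length es) (height-stacks s)))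

  unstack⇓ : ∀ L s → height-stacks s ≤ N → unstackProg ∶ encodeStacks L s ⇓ encodeList encodeElement (unstack s) ⟪ N ⟫
  unstack⇓ L (us , vs , ws) h≤N =
    ⟨ eval⇓ (tl ⨾ hd) , ⟨ eval⇓ (tl ⨾ tl ⨾ hd) , eval⇓ ⟨ tl ⨾ tl ⨾ tl , nil ⟩ ⨾⇓ reverse⇓ ws
      (≤-trans (m≤n+m _ (length vs)) (≤-trans (m≤n+m _ (length us)) h≤N)) ⟩⇓ ⨾⇓
      reverse⇓ vs (≤-trans (m≤m+n _ (length ws)) (≤-trans (m≤n+m _ (length us)) h≤N)) ⟩⇓ ⨾⇓
    reverse⇓ us (≤-trans (m≤m+n _ _) h≤N)

  encodeConstraint : Subset n → Tree
  encodeConstraint L = encodeSubset L ∙ encodeℕ (b L)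

  gather⇓ : ∀ L es → length es ≤ N → gatherProg ∶ encodeConstraint L ∙ encodeList encodeElement es ⇓
                       encodeList encodeElement (gather (lookup L) es) ⟪ N ⟫
  gather⇓ L es es≤N = eval⇓ ⟨ tl , ⟨ hd ⨾ hd , ⟨ nil , ⟨ nil , nil ⟩ ⟩ ⟩ ⟩ ⨾⇓
    each⇓ _ _ _ es≤N (go es ([] , [] , [])) ⨾⇓
    subst (λ xs → unstackProg ∶ encodeStacks L s ⇓ encodeList encodeElement xs ⟪ N ⟫)
      (unstack-gatherLoop (lookup L) es []) (unstack⇓ L s (≤-trans (≤-reflexive
        (trans (height-gatherLoop (lookup L) es ([] , [] , [])) (+-identityʳ _))) es≤N))
    where
    s = gatherLoop (lookup L) es ([] , [] , [])
    go : ∀ es s → Iterate gatherStepProg N encodeElement (encodeStacks L s) es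
                    (encodeStacks L (gatherLoop (lookup L) es s))
    go []       s = []
    go (e ∷ es) s = gatherStep⇓ L e s ∷ go es (gatherStep (lookup L) e s)

  order⇓ : each gatherProg ∶ encodeList encodeConstraint 𝓛 ∙ encodeList encodeElement (reverse (allFin n)) ⇓
             encodeList encodeElement order ⟪ N ⟫
  order⇓ = each⇓ _ _ _ 𝓛≤N (go 𝓛 (reverse (allFin n)) (≤-trans (≤-reflexive
    (trans (length-reverse (allFin n)) (length-tabulate id))) n≤N))
    where
    go : ∀ Ls es → length es ≤ N → Iterate gatherProg N encodeConstraint (encodeList encodeElement es) Ls
                     (encodeList encodeElement (gatherAll (map lookup Ls) es))
    go []       es es≤N = []
    go (L ∷ Ls) es es≤N = gather⇓ L es es≤N ∷ go Ls (gather (lookup L) es)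
      (≤-trans (≤-reflexive (↭-length (gather-↭ (lookup L) es))) es≤N)

  state : ℕ → Tree
  state t = encodeList encodeElement order ∙ encodeBits (reverse (counter top t))

  preprocess⇓ : preprocessProg ∶ encodeInput G M ⇓ state 0 ⟪ N ⟫
  preprocess⇓ =
    ⟨ allBits⇓ , eval⇓ skip ⟩⇓ ⨾⇓
    ⟨ eval⇓ hd , ⟨ eval⇓ ⟨ tl ⨾ hd , ⟨ hd , ⟨ ⟨ trueProg , nil ⟩ , nil ⟩ ⟩ ⟩ ⨾⇓ items⇓ ⨾⇓ eval⇓ (tl ⨾ tl) , eval⇓ (tl ⨾ tl) ⟩⇓ ⟩⇓ ⨾⇓
    ⟨ eval⇓ ⟨ tl ⨾ tl , tl ⨾ hd ⟩ ⨾⇓ order⇓ , eval⇓ hd ⨾⇓ falses⇓ allBits top≤N ⟩⇓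

  encodeItems : ℕ → List (Fin n × Bool) → Tree
  encodeItems j = encodeList (encodeItem j)

  -- The cases of `halve` are packed into a new phase and a new flag that work for every tail, which
  -- spares `levelStep⇓` the case distinction.
  halveStep⇓ : ∀ j τ e c ys → ∃[ τ′ ] ∃[ c′ ]
               (∀ xs → halve j τ ((e , c) ∷ xs) ≡ (e , c′) ∷ halve j τ′ xs) ×
               halveStep ∶ encodeItem (suc j) (e , c) ∙ encodeBool τ ∙ encodeItems j ys ⇓
                 encodeBool τ′ ∙ encodeItem j (e , c′) ∙ encodeItems j ys ⟪ N ⟫
  halveStep⇓ j τ e c ys with frequent j e | c
  ... | true  | _     = τ , true , (λ xs → refl) , eval⇓ halveStep
  ... | false | false = τ , false , (λ xs → refl) , eval⇓ halveStep
  halveStep⇓ j true  e c ys | false | true = false , true , (λ xs → refl) , eval⇓ halveStep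
  halveStep⇓ j false e c ys | false | true = true , false , (λ xs → refl) , eval⇓ halveStep

  levelStep⇓ : ∀ j τ xs → length xs ≤ N →
               levelStep ∶ encodeBool τ ∙ encodeItems (suc j) xs ⇓ encodeItems j (halve j τ xs) ⟪ N ⟫
  levelStep⇓ j τ xs xs≤N =
    let τ′ , it = go τ xs [] in
    eval⇓ ⟨ tl , ⟨ hd , nil ⟩ ⟩ ⨾⇓ each⇓ _ _ _ xs≤N it ⨾⇓ eval⇓ ⟨ tl , nil ⟩ ⨾⇓
    subst (λ ys → each skip ∶ encodeItems j (reverse (halve j τ xs)) ∙ nil ⇓ encodeItems j ys ⟪ N ⟫)
      (reverse-involutive (halve j τ xs)) (reverse⇓ (reverse (halve j τ xs)) (≤-trans (≤-reflexive
        (trans (length-reverse (halve j τ xs)) (length-halve τ xs))) xs≤N))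
    where
    length-halve : ∀ τ xs → length (halve j τ xs) ≡ length xs
    length-halve τ xs = trans (sym (length-map proj₁ (halve j τ xs)))
      (trans (cong length (halve-proj₁ j τ xs)) (length-map proj₁ xs))
    go : ∀ τ xs ys → ∃[ τ′ ] Iterate halveStep N (encodeItem (suc j)) (encodeBool τ ∙ encodeItems j ys) xs
                       (τ′ ∙ encodeItems j (halve j τ xs ʳ++ ys))
    go τ []             ys = encodeBool τ , []
    go τ ((e , c) ∷ xs) ys
      with τ′ , c′ , eq , p ← halveStep⇓ j τ e c ys
      with τ″ , it ← go τ′ xs ((e , c′) ∷ ys) =
      τ″ , p ∷ subst (λ zs → Iterate halveStep N (encodeItem (suc j)) _ xs (τ″ ∙ encodeItems j (zs ʳ++ ys)))
                 (sym (eq xs)) it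

  length-order : length order ≡ n
  length-order = trans (↭-length order-↭) (length-tabulate id)

  -- In the reversed list the bit of level `j` comes last, just as `halveAt` halves at level `j`
  -- after all higher levels.
  levels⇓ : ∀ bs j → j + length bs ≡ top →
            Iterate levelStep N encodeBool (encodeList encodeElement order) (reverse bs)
              (encodeItems j (halveAt j order bs))
  levels⇓ [] j eq rewrite trans (sym (+-identityʳ j)) eq =
    subst (λ x → Iterate levelStep N encodeBool x [] (encodeItems top (map (λ e → e , frequent top e) order)))
      (encodeList-map (encodeItem top) (λ e → e , frequent top e) order) []
  levels⇓ (b ∷ bs) j eq rewrite unfold-reverse b bs =
    _∷ʳ⇓_ _ _ _ (levels⇓ bs (suc j) (trans (sym (+-suc j (length bs))) eq))
      (levelStep⇓ j b (halveAt (suc j) order bs) (≤-trans (≤-reflexive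
        (trans (length-halveAt (suc j) order bs) length-order)) n≤N))

  cut⇓ : ∀ xs → length xs ≡ n → cutProg ∶ encodeItems 0 xs ⇓ encodeSubset (cutInto ⊥ xs) ⟪ N ⟫
  cut⇓ xs len = ⟨ eval⇓ skip , falses⇓ xs xs≤N ⟩⇓ ⨾⇓ each⇓ _ _ _ xs≤N
    (subst (λ s → Iterate insertStep N (encodeItem 0) (encodeBits s) xs (encodeSubset (cutInto ⊥ xs)))
      (sym zeros) (go xs ⊥))
    where
    xs≤N : length xs ≤ N
    xs≤N = ≤-trans (≤-reflexive len) n≤N
    zeros : reverse (replicate (length xs) false) ≡ toList (⊥ {n})
    zeros = trans (reverse-replicate (length xs) false)
      (trans (cong (λ k → replicate k false) len) (sym (toList-replicate n false)))
    go : ∀ xs S → Iterate insertStep N (encodeItem 0) (encodeSubset S) xs (encodeSubset (cutInto S xs))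
    go []                 S = []
    go ((e , true) ∷ xs)  S = then⇓ (eval⇓ (hd ⨾ tl ⨾ tl)) (insertProg⇓ e S n≤N) ∷ go xs (S [ e ]≔ inside)
    go ((e , false) ∷ xs) S = else⇓ (eval⇓ (hd ⨾ tl ⨾ tl)) (eval⇓ tl) ∷ go xs S

  step⇓ : ∀ t → stepProg ∶ state t ⇓ encodeSubset (π t) ∙ state (suc t) ⟪ N ⟫
  step⇓ t =
    ⟨ eval⇓ ⟨ tl , hd ⟩ ⨾⇓ each⇓ _ _ _ (≤-trans (≤-reflexive (length-reverse bs)) bs≤N)
        (levels⇓ bs 0 (length-counter top t)) ⨾⇓ cut⇓ (halveAt 0 order bs)
          (trans (length-halveAt 0 order bs) length-order)
    , ⟨ eval⇓ hd , eval⇓ tl ⨾⇓ incrementProg⇓ bs bs≤N ⟩⇓ ⟩⇓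
    where
    bs = counter top t
    bs≤N : length bs ≤ N
    bs≤N = ≤-trans (≤-reflexive (length-counter top t)) top≤N

-- Bounds in terms of the input size

length≤size : ∀ {A : Set} (enc : A → Tree) xs → length xs ≤ size (encodeList enc xs)
length≤size enc []       = z≤n
length≤size enc (x ∷ xs) = s≤s (≤-trans (length≤size enc xs) (m≤n+m _ (size (enc x))))

∈⇒size≤ : ∀ {A : Set} (enc : A → Tree) {x xs} → x ∈ˡ xs → size (enc x) ≤ size (encodeList enc xs)
∈⇒size≤ enc (here refl)    = ≤-trans (m≤m+n _ _) (n≤1+n _)
∈⇒size≤ enc (there {y} x∈) = ≤-trans (∈⇒size≤ enc x∈) (≤-trans (m≤n+m _ (size (enc y))) (n≤1+n _))

-- Applied to the lengths of the denominators, this bounds `top` by the size of the input.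
sum≤size : ∀ {A : Set} (enc : A → Tree) (f : A → ℕ) → (∀ x → f x ≤ size (enc x)) →
           ∀ xs → sum (map f xs) ≤ size (encodeList enc xs)
sum≤size enc f f≤ []       = z≤n
sum≤size enc f f≤ (x ∷ xs) = ≤-trans (+-mono-≤ (f≤ x) (sum≤size enc f f≤ xs)) (n≤1+n _)

-- `Implements` has one time bound for both preprocessing and steps.
common-poly : ∀ {f g} → PolynomiallyBounded f → PolynomiallyBounded g →
              ∃[ c ] ∃[ d ] (∀ N → .{{NonZero N}} → f N ≤ c * N ^ d × g N ≤ c * N ^ d)
common-poly {f} {g} p q with c , d , bound ← +-poly p q =
  c , d , λ N → ≤-trans (m≤m+n (f N) (g N)) (bound N) , ≤-trans (m≤n+m (g N) (f N)) (bound N)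

opaque
  -- Opaque, so that the constants stay abstract in the final proof.
  cost-bound : ∃[ c ] ∃[ d ] (∀ N → .{{NonZero N}} →
               cost preprocessProg N ≤ c * N ^ d × cost stepProg N ≤ c * N ^ d)
  cost-bound = common-poly {cost preprocessProg} {cost stepProg} (cost-poly preprocessProg) (cost-poly stepProg)

within-bound : ∀ {P x y N T} → P ∶ x ⇓ y ⟪ N ⟫ → cost P N ≤ T → P ∶ x ⇓ y within T
within-bound (bounded k≤ p) ≤T = _ , ≤-trans k≤ ≤T , p

module _ {n : ℕ} (G : CBGT n) (M : LaminarMatroid (CBGT.𝓘 G)) where
  open CBGT G
  open LaminarMatroid M
  open Solution G M

  private
    encodeRate : Fin n → Tree
    encodeRate e = encodeℚ≥0 (g e)

    rates : Tree
    rates = encodeList encodeRate (allFin n)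

    N : ℕ
    N = size (encodeInput G M)

    rates≤N : size rates ≤ N
    rates≤N = ≤-trans (m≤m+n (size rates) _) (n≤1+n _)

    length-binary≤ : ∀ m → length (binary m) ≤ size (encodeℕ m)
    length-binary≤ m =
      subst (λ x → length (binary m) ≤ size x) (sym (encodeℕ-binary m)) (length≤size encodeBool (binary m))

    numerator≤ : ∀ e → length (numerator e) ≤ size (encodeRate e)
    numerator≤ e = ≤-trans (length-binary≤ _) (≤-trans (m≤m+n _ _) (n≤1+n _))

    denominator≤ : ∀ e → length (denominator e) ≤ size (encodeRate e)
    denominator≤ e = ≤-trans (length-binary≤ (↧ₙ g e)) 
      (≤-trans (m≤n+m (size (encodeℕ (↧ₙ g e))) (size (encodeℕ (ℤ.∣ ↥ g e ∣)))) (n≤1+n _))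

    rate≤N : ∀ e → size (encodeRate e) ≤ N
    rate≤N e = ≤-trans (∈⇒size≤ encodeRate (∈-allFin e)) rates≤N

  open Implementation G M N
    (≤-trans (≤-reflexive (sym (length-tabulate id))) (≤-trans (length≤size encodeRate (allFin n)) rates≤N))
    (≤-trans (≤-reflexive top≡) (≤-trans (sum≤size encodeRate _ denominator≤ (allFin n)) rates≤N))
    (≤-trans (length≤size _ 𝓛) (≤-trans (m≤n+m _ (size rates)) (n≤1+n _)))
    (λ e → ≤-trans (numerator≤ e) (rate≤N e))
    (λ e → ≤-trans (denominator≤ e) (rate≤N e))

  implements : ∀ {T} → cost preprocessProg N ≤ T → cost stepProg N ≤ T →
               Implements algorithm (encodeInput G M) π T
  implements pre≤T step≤T =
    state , within-bound preprocess⇓ pre≤T , λ t → within-bound (step⇓ t) step≤T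

theorem4p14 : Σ[ A ∈ Algorithm ] Σ[ c ∈ ℕ ] Σ[ d ∈ ℕ ]
    (∀ (n : ℕ) (G : CBGT n) (M : LaminarMatroid (CBGT.𝓘 G)) →
    Σ[ π ∈ Schedule n ]
    Valid G π
    × HeightBelow G π (+ 4 / 1)
    × Implements A (encodeInput G M) π (c * size (encodeInput G M) ^ d))
theorem4p14 with c , d , bound ← cost-bound =
  algorithm , c , d , λ n G M →
    -- The input is a pair, so its size is a successor and the `NonZero` instance is found by
    -- reduction.
    let pre≤ , step≤ = bound (size (encodeInput G M)) in
    Solution.π G M , Solution.π-valid G M , Solution.π-height G M , implements G M pre≤ step≤
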